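{- There exist infinitely many real quadratic fields $\mathbb{Q}[\sqrt{\delta}]$ each of which contains infinitely many periodic continued fractions $[\overline{a_0,a_1,\dots,a_n}]$ with all $a_i\in\{1,2\}$.
   Context: For positive integers $a_0,\dots,a_n$, $[\overline{a_0,\dots,a_n}]$ denotes the real number whose continued fraction expansion is purely periodic with period $(a_0,\dots,a_n)$. "Infinitely many periodic continued fractions" means infinitely many distinct real numbers of this form (with varying $n$). -}

module Defs where

open import Data.Fin.Base using (Fin)
open import Data.Integer.Base using (+_; +0; +[1+_]; -[1+_])
open import Data.Nat.Base as ℕ using (ℕ; zero; suc)
open import Data.Nat.DivMod using (_mod_)
import Data.Nat.Properties as ℕ
open import Data.Product.Base using (∃; ∃-syntax; _×_; _,_)
open import Data.Rational.Base hiding (_⊔_)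
open import Data.Rational.Properties
import Data.Rational.Solver as ℚ-Solver
open import Data.Sum.Base using (_⊎_)
open import Function.Definitions using (Injective)
open import Level using (Level; 0ℓ; _⊔_)
open import Relation.Binary.Core using (Rel)
open import Relation.Binary.PropositionalEquality
  using (_≡_; refl; sym; trans; cong; cong₂; subst)
open import Relation.Nullary.Negation.Core using (¬_)
open import Relation.Unary using (Pred)

infix 4 _⟶_ _≃ℝ_
infixl 6 _+ℝ_
infixl 7 _*ℝ_

private
  variable
    a ℓ ℓ′ : Level

-- "Infinitely many elements of P, counted up to ≈": a sequence of elements
-- of P no two terms of which (at different indices) are related by ≈.
Infinite : {A : Set a} → Rel A ℓ → Pred A ℓ′ → Set (a ⊔ ℓ ⊔ ℓ′)
Infinite {A = A} _≈_ P = ∃ λ (f : ℕ → A) → (∀ i → P (f i)) × Injective _≡_ _≈_ f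

Cauchy : (ℕ → ℚ) → Set
Cauchy x = ∀ ε → 0ℚ < ε → ∃[ N ] ∀ m n → N ℕ.≤ m → N ℕ.≤ n → ∣ x m - x n ∣ < ε

record ℝ : Set where
  constructor mkℝ
  field
    seq    : ℕ → ℚ
    cauchy : Cauchy seq

open ℝ public

-- The rational sequence c converges to the real number x. Since seq x itself
-- converges to x, this says that c n - seq x n tends to zero.
_⟶_ : (ℕ → ℚ) → ℝ → Set
c ⟶ x = ∀ ε → 0ℚ < ε → ∃[ N ] ∀ n → N ℕ.≤ n → ∣ c n - seq x n ∣ < ε

_≃ℝ_ : Rel ℝ 0ℓ
x ≃ℝ y = seq x ⟶ y

module CauchyProperties where

  half : ∀ {ε} → 0ℚ < ε → 0ℚ < ½ * ε
  half {ε} 0<ε = subst (_< ½ * ε) (*-zeroʳ ½) (*-monoʳ-<-pos ½ 0<ε)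

  half+half : ∀ ε → ½ * ε + ½ * ε ≡ ε
  half+half ε = trans (sym (*-distribʳ-+ ε ½ ½)) (*-identityˡ ε)

  split-+ : ∀ a b c d → (a + c) - (b + d) ≡ (a - b) + (c - d)
  split-+ = solve 4 (λ a b c d → (a :+ c) :- (b :+ d) := (a :- b) :+ (c :- d)) refl
    where open ℚ-Solver.+-*-Solver

  split-* : ∀ a b c d → a * c - b * d ≡ a * (c - d) + d * (a - b)
  split-* = solve 4 (λ a b c d → a :* c :- b :* d := a :* (c :- d) :+ d :* (a :- b)) refl
    where open ℚ-Solver.+-*-Solver

  insert : ∀ a b → a ≡ b + (a - b)
  insert = solve 2 (λ a b → a := b :+ (a :- b)) refl
    where open ℚ-Solver.+-*-Solver

  max-≤ˡ : ∀ {k} M N → M ℕ.⊔ N ℕ.≤ k → M ℕ.≤ k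
  max-≤ˡ M N = ℕ.≤-trans (ℕ.m≤m⊔n M N)

  max-≤ʳ : ∀ {k} M N → M ℕ.⊔ N ℕ.≤ k → N ℕ.≤ k
  max-≤ʳ M N = ℕ.≤-trans (ℕ.m≤n⊔m M N)

  +-cauchy : ∀ x y → Cauchy x → Cauchy y → Cauchy (λ n → x n + y n)
  +-cauchy x y cx cy ε 0<ε
    with cx (½ * ε) (half 0<ε) | cy (½ * ε) (half 0<ε)
  ... | M , p | N , q = M ℕ.⊔ N , λ m n m≥ n≥ → begin-strict
    ∣ (x m + y m) - (x n + y n) ∣        ≡⟨ cong ∣_∣ (split-+ (x m) (x n) (y m) (y n)) ⟩
    ∣ (x m - x n) + (y m - y n) ∣        ≤⟨ ∣p+q∣≤∣p∣+∣q∣ (x m - x n) (y m - y n) ⟩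
    ∣ x m - x n ∣ + ∣ y m - y n ∣        <⟨ +-mono-< (p m n (max-≤ˡ M N m≥) (max-≤ˡ M N n≥))
                                                      (q m n (max-≤ʳ M N m≥) (max-≤ʳ M N n≥)) ⟩
    ½ * ε + ½ * ε                        ≡⟨ half+half ε ⟩
    ε                                    ∎
    where open ≤-Reasoning

  bounded : ∀ {x} → Cauchy x →
            ∃[ B ] Positive B × (∃[ N ] ∀ n → N ℕ.≤ n → ∣ x n ∣ ≤ B)
  bounded {x} cx with cx 1ℚ (positive⁻¹ 1ℚ)
  ... | N , p = ∣ x N ∣ + 1ℚ , B>0 , N , bound
    where
    B>0 : Positive (∣ x N ∣ + 1ℚ)
    B>0 = subst Positive (+-comm 1ℚ ∣ x N ∣)
            (pos+nonNeg⇒pos 1ℚ ∣ x N ∣ {{∣-∣-nonNeg (x N)}})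
    open ≤-Reasoning
    bound : ∀ n → N ℕ.≤ n → ∣ x n ∣ ≤ ∣ x N ∣ + 1ℚ
    bound n n≥ = begin
      ∣ x n ∣                   ≡⟨ cong ∣_∣ (insert (x n) (x N)) ⟩
      ∣ x N + (x n - x N) ∣     ≤⟨ ∣p+q∣≤∣p∣+∣q∣ (x N) (x n - x N) ⟩
      ∣ x N ∣ + ∣ x n - x N ∣   ≤⟨ +-monoʳ-≤ ∣ x N ∣ (<⇒≤ (p n N n≥ ℕ.≤-refl)) ⟩
      ∣ x N ∣ + 1ℚ              ∎

  shrink : ∀ B → Positive B → ∀ ε → 0ℚ < ε → ∃[ δ ] 0ℚ < δ × B * δ ≡ ½ * ε
  shrink B B>0 ε 0<ε = B⁻¹ * (½ * ε) , 0<δ , eq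
    where
    instance
      _ = B>0
      _ = pos⇒nonZero B
    B⁻¹ = 1/ B
    instance _ = 1/pos⇒pos B
    0<δ : 0ℚ < B⁻¹ * (½ * ε)
    0<δ = subst (_< B⁻¹ * (½ * ε)) (*-zeroʳ B⁻¹) (*-monoʳ-<-pos B⁻¹ (half 0<ε))
    eq : B * (B⁻¹ * (½ * ε)) ≡ ½ * ε
    eq = trans (sym (*-assoc B B⁻¹ (½ * ε)))
           (trans (cong (_* (½ * ε)) (*-inverseʳ B)) (*-identityˡ (½ * ε)))

  scaled : ∀ B → Positive B → ∀ {b c δ} → ∣ b ∣ ≤ B → ∣ c ∣ < δ → ∣ b * c ∣ < B * δ
  scaled B B>0 {b} {c} {δ} b≤B c<δ = begin-strict
    ∣ b * c ∣      ≡⟨ ∣p*q∣≡∣p∣*∣q∣ b c ⟩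
    ∣ b ∣ * ∣ c ∣  ≤⟨ *-monoʳ-≤-nonNeg ∣ c ∣ {{∣-∣-nonNeg c}} b≤B ⟩
    B * ∣ c ∣      <⟨ *-monoʳ-<-pos B {{B>0}} c<δ ⟩
    B * δ          ∎
    where open ≤-Reasoning

  product-bound : ∀ B C → Positive B → Positive C → ∀ a b c d β γ →
    ∣ a ∣ ≤ B → ∣ d ∣ ≤ C → ∣ c - d ∣ < β → ∣ a - b ∣ < γ →
    ∣ a * c - b * d ∣ < B * β + C * γ
  product-bound B C B>0 C>0 a b c d β γ a≤B d≤C c-d<β a-b<γ = begin-strict
    ∣ a * c - b * d ∣                    ≡⟨ cong ∣_∣ (split-* a b c d) ⟩
    ∣ a * (c - d) + d * (a - b) ∣        ≤⟨ ∣p+q∣≤∣p∣+∣q∣ (a * (c - d)) (d * (a - b)) ⟩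
    ∣ a * (c - d) ∣ + ∣ d * (a - b) ∣    <⟨ +-mono-< {∣ a * (c - d) ∣} {B * β} {∣ d * (a - b) ∣} {C * γ}
                                               (scaled B B>0 {a} {c - d} a≤B c-d<β)
                                               (scaled C C>0 {d} {a - b} d≤C a-b<γ) ⟩
    B * β + C * γ                        ∎
    where open ≤-Reasoning

  *-cauchy : ∀ x y → Cauchy x → Cauchy y → Cauchy (λ n → x n * y n)
  *-cauchy x y cx cy ε 0<ε =
    let B , B>0 , K , x≤B = bounded cx
        C , C>0 , L , y≤C = bounded cy
        β , 0<β , Bβ≡ = shrink B B>0 ε 0<ε
        γ , 0<γ , Cγ≡ = shrink C C>0 ε 0<ε
        M , p = cx γ 0<γ
        N , q = cy β 0<β
    in (K ℕ.⊔ L) ℕ.⊔ (M ℕ.⊔ N) , λ m n m≥ n≥ →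
      let m≥KL = max-≤ˡ (K ℕ.⊔ L) (M ℕ.⊔ N) m≥
          n≥KL = max-≤ˡ (K ℕ.⊔ L) (M ℕ.⊔ N) n≥
          m≥MN = max-≤ʳ (K ℕ.⊔ L) (M ℕ.⊔ N) m≥
          n≥MN = max-≤ʳ (K ℕ.⊔ L) (M ℕ.⊔ N) n≥
      in subst (∣ x m * y m - x n * y n ∣ <_)
           (trans (cong₂ _+_ Bβ≡ Cγ≡) (half+half ε))
           (product-bound B C B>0 C>0 (x m) (x n) (y m) (y n) β γ
             (x≤B m (max-≤ˡ K L m≥KL)) (y≤C n (max-≤ʳ K L n≥KL))
             (q m n (max-≤ʳ M N m≥MN) (max-≤ʳ M N n≥MN))
             (p m n (max-≤ˡ M N m≥MN) (max-≤ˡ M N n≥MN)))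

open CauchyProperties using (+-cauchy; *-cauchy)

fromℚ : ℚ → ℝ
fromℚ q = mkℝ (λ _ → q) λ ε 0<ε →
  0 , λ _ _ _ _ → subst (_< ε) (sym (cong ∣_∣ (+-inverseʳ q))) 0<ε

fromℕ : ℕ → ℝ
fromℕ n = fromℚ (+ n / 1)

_+ℝ_ : ℝ → ℝ → ℝ
x +ℝ y = mkℝ (λ n → seq x n + seq y n) (+-cauchy (seq x) (seq y) (cauchy x) (cauchy y))

_*ℝ_ : ℝ → ℝ → ℝ
x *ℝ y = mkℝ (λ n → seq x n * seq y n) (*-cauchy (seq x) (seq y) (cauchy x) (cauchy y))

NonSquare : ℕ → Set
NonSquare δ = ¬ (∃[ m ] m ℕ.* m ≡ δ)

-- The subset {p + q√δ : p, q ∈ ℚ} of ℝ. Either square root of δ may serve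
-- as s, since ℚ[√δ] = ℚ[-√δ]. It is a real quadratic field when δ is
-- not a perfect square.
ℚ[√_] : ℕ → Pred ℝ 0ℓ
ℚ[√ δ ] x = ∃[ s ] s *ℝ s ≃ℝ fromℕ δ ×
            (∃[ p ] ∃[ q ] x ≃ℝ fromℚ p +ℝ fromℚ q *ℝ s)

-- The value at zero is arbitrary. It is never used by the convergents of a
-- continued fraction with positive partial quotients.
recip : ℚ → ℚ
recip (mkℚ +0 _ _)           = 0ℚ
recip p@(mkℚ +[1+ _ ] _ _)   = 1/ p
recip p@(mkℚ (-[1+ _ ]) _ _) = 1/ p

-- convergent a n = [a₀; a₁, …, aₙ]
convergent : (ℕ → ℕ) → ℕ → ℚ
convergent a zero    = + a 0 / 1
convergent a (suc n) = + a 0 / 1 + recip (convergent (λ i → a (suc i)) n)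

-- x = [a₀, …, aₙ] with the whole word repeated: the infinite continued
-- fraction is, by definition, the limit of its convergents.
_IsPeriodicCF_ : ∀ {n} → ℝ → (Fin (suc n) → ℕ) → Set
_IsPeriodicCF_ {n} x a = convergent (λ i → a (i mod suc n)) ⟶ x

PeriodicCF₁₂ : Pred ℝ 0ℓ
PeriodicCF₁₂ x = ∃[ n ] ∃ λ (a : Fin (suc n) → ℕ) →
                 (∀ i → a i ≡ 1 ⊎ a i ≡ 2) × x IsPeriodicCF a

{-# OPTIONS --safe #-}
module Submission where

-- Fix an even k, let N be the word 1ᵏ and u the word N 1 1 2. Its matrix is
-- t + V with V² = δ, where t = F_{k+4} and δ = F_{k+3} F_{k+5} = t² + 1. The
-- matrix of the word
--   1 N 2 1 1 uʲ N 2 1 uʲ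
-- has the same trace and determinant as the matrix of u^{2j+2}: this is a
-- polynomial identity in F_k, F_{k-1} and the entries of the matrix of uʲ. So
-- the periodic continued fraction with this period lies in ℚ(√δ), for every j.
-- If its matrix is (A B; C D), then (A - D) / C determines j, and it is
-- determined by the continued fraction because √δ is irrational.
--
-- For infinitely many fields, k is chosen along a sequence for which δ divides
-- F_{k′+4}² for all later k′. Then the values of δ are pairwise coprime, since
-- δ′ = F_{k′+4}² + 1, and pairwise coprime non-squares define distinct fields.
--
-- Convergence: the quadratic form fixed by the matrix of the period is
-- multiplied by ± 1 / (C x + D)² when x passes through a period, so it tends
-- to zero along the convergents.

open import Defs
open import Data.Nat.Base as ℕ using (ℕ; zero; suc)
open import Data.Product.Base using (∃-syntax; _×_; _,_; proj₁; proj₂)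
open import Data.Sum.Base using (_⊎_; inj₁; inj₂)
open import Data.List.Base using (List; []; _∷_; length; lookup; replicate; _++_)
open import Data.List.Relation.Unary.All as All using (All; []; _∷_)
import Data.List.Relation.Unary.All.Properties as All
open import Data.Nat.Coprimality as ℕ using (Coprime; 1-coprimeTo; coprime-divisor)
open import Data.Nat.Divisibility
  using (_∣_; module _∣_; divides; ∣-refl; ∣-trans; ∣1⇒≡1; _∣0; m∣m*n; n∣m*n; ∣m∣n⇒∣m+n; ∣m+n∣m⇒∣n; *-pres-∣)
import Data.Nat.Properties as ℕ
open import Function.Base using (_∘_; id)
open import Relation.Binary.PropositionalEquality
open import Relation.Nullary using (¬_; yes; no; contradiction)
open import Relation.Unary using (_∩_; _≐_; _⊆_)

-- Matrices of words and the polynomial identities between their entries.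

module Words where
  open import Data.Nat.Base
  open import Data.Nat.Properties
  open import Data.Nat.Solver using (module +-*-Solver)
  open +-*-Solver

  record Mat (R : Set) : Set where
    constructor mat
    field A B C D : R

  -- The product of the matrices (x 1; 1 0) over the letters x. As a Möbius map it sends z to the
  -- continued fraction that starts with the word and goes on with z.
  matrix : List ℕ → Mat ℕ
  matrix []      = mat 1 0 0 1
  matrix (x ∷ w) = let mat a b c d = matrix w in mat (x ℕ.* a ℕ.+ c) (x ℕ.* b ℕ.+ d) a b

  infixr 5 _++ˢ_

  _++ˢ_ : List ℕ → (ℕ → ℕ) → ℕ → ℕ
  ([]      ++ˢ s) i       = s i
  ((x ∷ w) ++ˢ s) zero    = x
  ((x ∷ w) ++ˢ s) (suc i) = (w ++ˢ s) i

  OneOrTwo : ℕ → Set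
  OneOrTwo a = a ≡ 1 ⊎ a ≡ 2

  -- Every formula is needed both as a function on ℕ and as a polynomial for the
  -- ring solver.
  module Formulas {R : Set} (_⊞_ _⊠_ : R → R → R) (# : ℕ → R) where
    infixl 6 _+′_
    infixl 7 _*′_ _⊗_

    private
      _+′_ = _⊞_
      _*′_ = _⊠_

    _⊗_ : Mat R → Mat R → Mat R
    mat a b c d ⊗ mat a′ b′ c′ d′ =
      mat (a *′ a′ +′ b *′ c′) (a *′ b′ +′ b *′ d′) (c *′ a′ +′ d *′ c′) (c *′ b′ +′ d *′ d′)

    step : R → Mat R → Mat R
    step x (mat a b c d) = mat (x *′ a +′ c) (x *′ b +′ d) a b

    -- For p = F_k and r = F_{k-1}: t = F_{k+4} and b = F_{k+3}.
    t b δ : R → R → R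
    t p r = # 5 *′ p +′ # 3 *′ r
    b p r = # 3 *′ p +′ # 2 *′ r
    δ p r = b p r *′ (# 8 *′ p +′ # 5 *′ r)

    -- The matrices of the words `1ᵏ`, 1 `1ᵏ` 2 1 1 and `1ᵏ` 2 1.
    ones prefix middle : R → R → Mat R
    ones p r   = mat (p +′ r) p p r
    prefix p r = mat (# 12 *′ p +′ # 7 *′ r) (# 7 *′ p +′ # 4 *′ r) (# 7 *′ p +′ # 5 *′ r) (# 4 *′ p +′ # 3 *′ r)
    middle p r = mat (# 4 *′ p +′ # 3 *′ r) (# 3 *′ p +′ # 2 *′ r) (# 3 *′ p +′ r) (# 2 *′ p +′ r)

    -- (d + b s) + s V, where V = (b b; t -b).
    power : (p r d s : R) → Mat R
    power p r d s = mat (d +′ # 2 *′ b p r *′ s) (b p r *′ s) (t p r *′ s) d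

    -- Multiplication by t + V, the matrix of u, in the coordinates d and s of `power`.
    d⁺ s⁺ : (p r d s : R) → R
    d⁺ p r d s = (# 2 *′ p +′ r) *′ d +′ t p r *′ b p r *′ s
    s⁺ p r d s = d +′ (# 8 *′ p +′ # 5 *′ r) *′ s

    period : (p r d s : R) → Mat R
    period p r d s = prefix p r ⊗ (power p r d s ⊗ (middle p r ⊗ power p r d s))

    -- 4 T S, where T + S V is the matrix of u^{j+1}.
    f : (p r d s : R) → R
    f p r d s = # 4 *′ (d⁺ p r d s +′ b p r *′ s⁺ p r d s) *′ s⁺ p r d s

    -- `h₀`, `h₁` and `h₂` are the coefficients of A - D for `period`, as a quadratic form in d and
    -- s. None is negative, so A - D makes sense over ℕ.
    h₀ h₁ h₂ m₀₁ m₀₂ m₁₂ : R → R → R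
    h₀ p r = # 40 *′ p *′ p +′ # 44 *′ p *′ r +′ # 12 *′ r *′ r
    h₁ p r = # 852 *′ p *′ p *′ p +′ # 1540 *′ p *′ p *′ r +′ # 924 *′ p *′ r *′ r +′ # 184 *′ r *′ r *′ r
    h₂ p r = # 4248 *′ p *′ p *′ p *′ p +′ # 10560 *′ p *′ p *′ p *′ r +′ # 9820 *′ p *′ p *′ r *′ r
             +′ # 4048 *′ p *′ r *′ r *′ r +′ # 624 *′ r *′ r *′ r *′ r

    -- m_ij = h_j c_i - h_i c_j, where C = c₀ d² + c₁ d s + c₂ s².
    m₀₁ p r = # 816 *′ (r *′ r *′ r *′ r *′ r) +′ p *′
      (# 6240 *′ p *′ p *′ p *′ p +′ # 20984 *′ p *′ p *′ p *′ r +′ # 28064 *′ p *′ p *′ r *′ r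
       +′ # 18672 *′ p *′ r *′ r *′ r +′ # 6184 *′ r *′ r *′ r *′ r)
    m₀₂ p r = # 49680 *′ p *′ p *′ p *′ p *′ p *′ p +′ # 198648 *′ p *′ p *′ p *′ p *′ p *′ r
      +′ # 329664 *′ p *′ p *′ p *′ p *′ r *′ r +′ # 290736 *′ p *′ p *′ p *′ r *′ r *′ r
      +′ # 143752 *′ p *′ p *′ r *′ r *′ r *′ r +′ # 37792 *′ p *′ r *′ r *′ r *′ r *′ r
      +′ # 4128 *′ r *′ r *′ r *′ r *′ r *′ r
    m₁₂ p r = # 395496 *′ p *′ p *′ p *′ p *′ p *′ p *′ p +′ # 1832976 *′ p *′ p *′ p *′ p *′ p *′ p *′ r
      +′ # 3630384 *′ p *′ p *′ p *′ p *′ p *′ r *′ r +′ # 3983800 *′ p *′ p *′ p *′ p *′ r *′ r *′ r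
      +′ # 2616192 *′ p *′ p *′ p *′ r *′ r *′ r *′ r +′ # 1028288 *′ p *′ p *′ r *′ r *′ r *′ r *′ r
      +′ # 224000 *′ p *′ r *′ r *′ r *′ r *′ r *′ r +′ # 20864 *′ r *′ r *′ r *′ r *′ r *′ r *′ r

    form : (a₀ a₁ a₂ d s : R) → R
    form a₀ a₁ a₂ d s = a₀ *′ d *′ d +′ a₁ *′ d *′ s +′ a₂ *′ s *′ s

    H : (p r d s : R) → R
    H p r d s = form (h₀ p r) (h₁ p r) (h₂ p r) d s

    M : (p r d s d′ s′ : R) → R
    M p r d s d′ s′ = m₀₁ p r *′ (d *′ d′) +′ (m₀₂ p r *′ (s *′ d′ +′ d *′ s′) +′ m₁₂ p r *′ s *′ s′)

  open Formulas _+_ _*_ id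

  module P {n} = Formulas (_:+_ {n}) _:*_ con

  A≡H+D : ∀ p r d s → let open Mat (period p r d s) in A ≡ H p r d s + D
  A≡H+D = solve 4 (λ p r d s → let open Mat (P.period p r d s) in A := P.H p r d s :+ D) refl

  -- Since `H` is A - D, the left side is the squared trace minus four times the determinant. For
  -- the word u^{2j+2}, whose matrix is (T + S V)², this quantity is (4 T S)² δ.
  discriminant : ∀ p r d s → let open Mat (period p r d s) in
    H p r d s * H p r d s + 4 * (B * C) ≡ δ p r * (f p r d s * f p r d s)
  discriminant = solve 4 (λ p r d s → let open Mat (P.period p r d s) in
    P.H p r d s :* P.H p r d s :+ con 4 :* (B :* C) := P.δ p r :* (P.f p r d s :* P.f p r d s)) refl

  -- For two quadratic forms H and C, the expression H(v) C(v′) - H(v′) C(v) vanishes when v and v′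
  -- are proportional. So it is divisible by the determinant of v and v′, and the quotient is made
  -- of the minors of the coefficients. The terms are arranged to avoid subtraction.
  cross-product : ∀ p r d s d′ s′ →
    H p r d s * Mat.C (period p r d′ s′) + M p r d s d′ s′ * (d * s′) ≡
    H p r d′ s′ * Mat.C (period p r d s) + M p r d s d′ s′ * (d′ * s)
  cross-product = solve 6 (λ p r d s d′ s′ →
    P.H p r d s :* Mat.C (P.period p r d′ s′) :+ P.M p r d s d′ s′ :* (d :* s′) :=
    P.H p r d′ s′ :* Mat.C (P.period p r d s) :+ P.M p r d s d′ s′ :* (d′ :* s)) refl

  mat-cong : ∀ {a a′ b b′ c c′ d d′ : ℕ} → a ≡ a′ → b ≡ b′ → c ≡ c′ → d ≡ d′ →
             mat a b c d ≡ mat a′ b′ c′ d′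
  mat-cong refl refl refl refl = refl

  matrix-++ : ∀ v w → matrix (v ++ w) ≡ matrix v ⊗ matrix w
  matrix-++ [] w = mat-cong (unit A) (unit B) (sym (+-identityʳ C)) (sym (+-identityʳ D))
    where
    open Mat (matrix w)
    unit : ∀ x → x ≡ x + 0 + 0
    unit x = sym (trans (+-identityʳ (x + 0)) (+-identityʳ x))
  matrix-++ (x ∷ v) w = trans (cong (step x) (matrix-++ v w))
    (mat-cong (expand A B C D A′ C′ x) (expand A B C D B′ D′ x) refl refl)
    where
    open Mat (matrix v)
    open Mat (matrix w) using () renaming (A to A′; B to B′; C to C′; D to D′)
    expand : ∀ a b c d a′ c′ x → x * (a * a′ + b * c′) + (c * a′ + d * c′) ≡ (x * a + c) * a′ + (x * b + d) * c′
    expand = solve 7 (λ a b c d a′ c′ x →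
      x :* (a :* a′ :+ b :* c′) :+ (c :* a′ :+ d :* c′) := (x :* a :+ c) :* a′ :+ (x :* b :+ d) :* c′) refl

  -- F_{2h} and F_{2h-1}
  P R : ℕ → ℕ
  P zero    = 0
  P (suc h) = 2 * P h + R h
  R zero    = 1
  R (suc h) = P h + R h

  matrix-ones : ∀ h → matrix (replicate (h * 2) 1) ≡ ones (P h) (R h)
  matrix-ones zero    = refl
  matrix-ones (suc h) = trans (cong (step 1 ∘ step 1) (matrix-ones h))
    (mat-cong (solve 2 (λ p r → A (left p r) := A (right p r)) refl (P h) (R h))
              (solve 2 (λ p r → B (left p r) := B (right p r)) refl (P h) (R h))
              (solve 2 (λ p r → C (left p r) := C (right p r)) refl (P h) (R h))
              (solve 2 (λ p r → D (left p r) := D (right p r)) refl (P h) (R h)))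
    where
    open Mat
    left right : ∀ {n} (p r : Polynomial n) → Mat (Polynomial n)
    left p r  = P.step (con 1) (P.step (con 1) (P.ones p r))
    right p r = P.ones (con 2 :* p :+ r) (p :+ r)

  0<R : ∀ h → 0 < R h
  0<R zero    = s≤s z≤n
  0<R (suc h) = ≤-trans (0<R h) (m≤n+m (R h) (P h))

  -- Cassini's identity F_{k-1} F_{k+1} = F_k² + 1 for k = 2h.
  cassini : ∀ h → R h * R h + P h * R h ≡ P h * P h + 1
  cassini zero    = refl
  -- The difference of the two sides is the same for `suc h` as for `h`; a common summand replaces
  -- the subtraction.
  cassini (suc h) = +-cancelʳ-≡ (P h * P h + 1) _ _ (begin
    R (suc h) * R (suc h) + P (suc h) * R (suc h) + (P h * P h + 1)
      ≡⟨ solve 2 (λ p r → let p′ = con 2 :* p :+ r; r′ = p :+ r in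
           r′ :* r′ :+ p′ :* r′ :+ (p :* p :+ con 1) := p′ :* p′ :+ con 1 :+ (r :* r :+ p :* r)) refl (P h) (R h) ⟩
    P (suc h) * P (suc h) + 1 + (R h * R h + P h * R h)
      ≡⟨ cong (P (suc h) * P (suc h) + 1 +_) (cassini h) ⟩
    P (suc h) * P (suc h) + 1 + (P h * P h + 1) ∎)
    where open ≡-Reasoning

  -- Cassini's identity at k + 4, reduced to the one at k.
  δ≡t²+1 : ∀ h → δ (P h) (R h) ≡ t (P h) (R h) * t (P h) (R h) + 1
  δ≡t²+1 h = +-cancelʳ-≡ (p * p) _ _ (begin
    δ p r + p * p                        ≡⟨ solve 2 (λ p r → P.δ p r :+ p :* p := P.t p r :* P.t p r :+ (r :* r :+ p :* r)) refl p r ⟩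
    t p r * t p r + (r * r + p * r)      ≡⟨ cong (t p r * t p r +_) (cassini h) ⟩
    t p r * t p r + (p * p + 1)          ≡⟨ solve 2 (λ t pp → t :* t :+ (pp :+ con 1) := t :* t :+ con 1 :+ pp) refl (t p r) (p * p) ⟩
    t p r * t p r + 1 + p * p            ∎)
    where
    open ≡-Reasoning
    p = P h
    r = R h

  -- The number lies strictly between the consecutive squares t² and (t + 1)².
  t²+1-nonsquare : ∀ {t} → 0 < t → NonSquare (t * t + 1)
  t²+1-nonsquare {t} 0<t (m , m²≡) with m ≤? t
  ... | yes m≤t = <-irrefl refl (begin-strict
    t * t       <⟨ n<1+n (t * t) ⟩
    suc (t * t) ≡⟨ +-comm (t * t) 1 ⟨
    t * t + 1   ≡⟨ m²≡ ⟨
    m * m       ≤⟨ *-mono-≤ m≤t m≤t ⟩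
    t * t       ∎)
    where open ≤-Reasoning
  ... | no m≰t = <-irrefl refl (begin-strict
    t * t + 1          <⟨ +-monoʳ-< (t * t) (s≤s (≤-trans 0<t (m≤m+n t t))) ⟩
    t * t + suc (t + t) ≡⟨ solve 1 (λ t → t :* t :+ (con 1 :+ (t :+ t)) := (con 1 :+ t) :* (con 1 :+ t)) refl t ⟩
    suc t * suc t      ≤⟨ *-mono-≤ (≰⇒> m≰t) (≰⇒> m≰t) ⟩
    m * m              ≡⟨ m²≡ ⟩
    t * t + 1          ∎)
    where open ≤-Reasoning

  -- The periods for a fixed field.

  module Period (h : ℕ) where

    p = P h
    r = R h

    d s : ℕ → ℕ
    d zero    = 1
    d (suc j) = d⁺ p r (d j) (s j)
    s zero    = 0
    s (suc j) = s⁺ p r (d j) (s j)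

    1ᵏ : List ℕ
    1ᵏ = replicate (h * 2) 1

    blocks : ℕ → List ℕ
    blocks zero    = []
    blocks (suc j) = 1ᵏ ++ 1 ∷ 1 ∷ 2 ∷ blocks j

    -- The first letter is split off because the lower row of the matrix of the word is the upper
    -- row of the matrix of its tail.
    tail word : ℕ → List ℕ
    tail j = 1ᵏ ++ 2 ∷ 1 ∷ 1 ∷ (blocks j ++ 1ᵏ ++ 2 ∷ 1 ∷ blocks j)
    word j = 1 ∷ tail j

    matrix-blocks : ∀ j → matrix (blocks j) ≡ power p r (d j) (s j)
    matrix-blocks zero    = mat-cong (cong suc (sym (*-zeroʳ (2 * b p r)))) (sym (*-zeroʳ (b p r))) (sym (*-zeroʳ (t p r))) refl
    matrix-blocks (suc j) = begin
      matrix (1ᵏ ++ 1 ∷ 1 ∷ 2 ∷ blocks j)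
        ≡⟨ matrix-++ 1ᵏ (1 ∷ 1 ∷ 2 ∷ blocks j) ⟩
      matrix 1ᵏ ⊗ step 1 (step 1 (step 2 (matrix (blocks j))))
        ≡⟨ cong₂ (λ X Y → X ⊗ step 1 (step 1 (step 2 Y))) (matrix-ones h) (matrix-blocks j) ⟩
      ones p r ⊗ step 1 (step 1 (step 2 (power p r (d j) (s j))))
        ≡⟨ mat-cong (solve 4 (λ p r d s → A (left p r d s) := A (right p r d s)) refl p r (d j) (s j))
                    (solve 4 (λ p r d s → B (left p r d s) := B (right p r d s)) refl p r (d j) (s j))
                    (solve 4 (λ p r d s → C (left p r d s) := C (right p r d s)) refl p r (d j) (s j))
                    (solve 4 (λ p r d s → D (left p r d s) := D (right p r d s)) refl p r (d j) (s j)) ⟩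
      power p r (d (suc j)) (s (suc j)) ∎
      where
      open ≡-Reasoning
      open Mat
      left right : ∀ {n} (p r d s : Polynomial n) → Mat (Polynomial n)
      left p r d s  = P.ones p r P.⊗ P.step (con 1) (P.step (con 1) (P.step (con 2) (P.power p r d s)))
      right p r d s = P.power p r (P.d⁺ p r d s) (P.s⁺ p r d s)

    matrix-prefix : ∀ v → matrix (1 ∷ 1ᵏ ++ 2 ∷ 1 ∷ 1 ∷ v) ≡ prefix p r ⊗ matrix v
    matrix-prefix v = begin
      step 1 (matrix (1ᵏ ++ 2 ∷ 1 ∷ 1 ∷ v))
        ≡⟨ cong (step 1) (matrix-++ 1ᵏ (2 ∷ 1 ∷ 1 ∷ v)) ⟩
      step 1 (matrix 1ᵏ ⊗ step 2 (step 1 (step 1 (matrix v))))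
        ≡⟨ cong (λ X → step 1 (X ⊗ step 2 (step 1 (step 1 (matrix v))))) (matrix-ones h) ⟩
      step 1 (ones p r ⊗ step 2 (step 1 (step 1 (matrix v))))
        ≡⟨ mat-cong (solve 6 (λ p r a b c d → A (left p r (mat a b c d)) := A (right p r (mat a b c d))) refl p r A′ B′ C′ D′)
                    (solve 6 (λ p r a b c d → B (left p r (mat a b c d)) := B (right p r (mat a b c d))) refl p r A′ B′ C′ D′)
                    (solve 6 (λ p r a b c d → C (left p r (mat a b c d)) := C (right p r (mat a b c d))) refl p r A′ B′ C′ D′)
                    (solve 6 (λ p r a b c d → D (left p r (mat a b c d)) := D (right p r (mat a b c d))) refl p r A′ B′ C′ D′) ⟩
      prefix p r ⊗ matrix v ∎
      where
      open ≡-Reasoning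
      open Mat
      open Mat (matrix v) using () renaming (A to A′; B to B′; C to C′; D to D′)
      left right : ∀ {n} (p r : Polynomial n) → Mat (Polynomial n) → Mat (Polynomial n)
      left p r V  = P.step (con 1) (P.ones p r P.⊗ P.step (con 2) (P.step (con 1) (P.step (con 1) V)))
      right p r V = P.prefix p r P.⊗ V

    matrix-middle : ∀ v → matrix (1ᵏ ++ 2 ∷ 1 ∷ v) ≡ middle p r ⊗ matrix v
    matrix-middle v = begin
      matrix (1ᵏ ++ 2 ∷ 1 ∷ v)
        ≡⟨ matrix-++ 1ᵏ (2 ∷ 1 ∷ v) ⟩
      matrix 1ᵏ ⊗ step 2 (step 1 (matrix v))
        ≡⟨ cong (_⊗ step 2 (step 1 (matrix v))) (matrix-ones h) ⟩
      ones p r ⊗ step 2 (step 1 (matrix v))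
        ≡⟨ mat-cong (solve 6 (λ p r a b c d → A (left p r (mat a b c d)) := A (right p r (mat a b c d))) refl p r A′ B′ C′ D′)
                    (solve 6 (λ p r a b c d → B (left p r (mat a b c d)) := B (right p r (mat a b c d))) refl p r A′ B′ C′ D′)
                    (solve 6 (λ p r a b c d → C (left p r (mat a b c d)) := C (right p r (mat a b c d))) refl p r A′ B′ C′ D′)
                    (solve 6 (λ p r a b c d → D (left p r (mat a b c d)) := D (right p r (mat a b c d))) refl p r A′ B′ C′ D′) ⟩
      middle p r ⊗ matrix v ∎
      where
      open ≡-Reasoning
      open Mat
      open Mat (matrix v) using () renaming (A to A′; B to B′; C to C′; D to D′)
      left right : ∀ {n} (p r : Polynomial n) → Mat (Polynomial n) → Mat (Polynomial n)
      left p r V  = P.ones p r P.⊗ P.step (con 2) (P.step (con 1) V)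
      right p r V = P.middle p r P.⊗ V

    matrix-word : ∀ j → matrix (word j) ≡ period p r (d j) (s j)
    matrix-word j = begin
      matrix (word j)
        ≡⟨ matrix-prefix (blocks j ++ 1ᵏ ++ 2 ∷ 1 ∷ blocks j) ⟩
      prefix p r ⊗ matrix (blocks j ++ 1ᵏ ++ 2 ∷ 1 ∷ blocks j)
        ≡⟨ cong (prefix p r ⊗_) (matrix-++ (blocks j) (1ᵏ ++ 2 ∷ 1 ∷ blocks j)) ⟩
      prefix p r ⊗ (matrix (blocks j) ⊗ matrix (1ᵏ ++ 2 ∷ 1 ∷ blocks j))
        ≡⟨ cong (λ X → prefix p r ⊗ (matrix (blocks j) ⊗ X)) (matrix-middle (blocks j)) ⟩
      prefix p r ⊗ (matrix (blocks j) ⊗ (middle p r ⊗ matrix (blocks j)))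
        ≡⟨ cong (λ X → prefix p r ⊗ (X ⊗ (middle p r ⊗ X))) (matrix-blocks j) ⟩
      period p r (d j) (s j) ∎
      where open ≡-Reasoning

    word-12 : ∀ j → All OneOrTwo (word j)
    word-12 j = one ∷ All.++⁺ ones-12 (two ∷ one ∷ one ∷
        All.++⁺ (blocks-12 j) (All.++⁺ ones-12 (two ∷ one ∷ blocks-12 j)))
      where
      one : OneOrTwo 1
      one = inj₁ refl
      two : OneOrTwo 2
      two = inj₂ refl
      ones-12 : All OneOrTwo 1ᵏ
      ones-12 = All.replicate⁺ (h * 2) one
      blocks-12 : ∀ j → All OneOrTwo (blocks j)
      blocks-12 zero    = []
      blocks-12 (suc j) = All.++⁺ ones-12 (one ∷ one ∷ two ∷ blocks-12 j)

    0<t : 0 < t p r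
    0<t = ≤-trans (0<R h) (≤-trans (m≤m+n r (2 * r)) (m≤n+m (3 * r) (5 * p)))

    δ-nonsquare : NonSquare (δ p r)
    δ-nonsquare = subst NonSquare (sym (δ≡t²+1 h)) (t²+1-nonsquare 0<t)

    0<d : ∀ j → 0 < d j
    0<d zero    = s≤s z≤n
    0<d (suc j) = ≤-trans (*-mono-≤ (≤-trans (0<R h) (m≤n+m r (2 * p))) (0<d j)) (m≤m+n _ _)

    0<s : ∀ j → 0 < s (suc j)
    0<s j = ≤-trans (0<d j) (m≤m+n (d j) _)

    -- d i * s j - d j * s i changes sign at each step.
    cross-step : ∀ i j → d (suc i) * s (suc j) + d i * s j ≡ d (suc j) * s (suc i) + d j * s i
    cross-step i j = +-cancelʳ-≡ (p * p * (d i * s j + d j * s i)) _ _ (begin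
      d (suc i) * s (suc j) + d i * s j + p * p * (d i * s j + d j * s i)
        ≡⟨ solve 4 (λ x u v pp → x :+ u :+ pp :* (u :+ v) := x :+ (pp :+ con 1) :* u :+ pp :* v) refl (d (suc i) * s (suc j)) (d i * s j) (d j * s i) (p * p) ⟩
      d (suc i) * s (suc j) + (p * p + 1) * (d i * s j) + p * p * (d j * s i)
        ≡⟨ cong (λ z → d (suc i) * s (suc j) + z * (d i * s j) + p * p * (d j * s i)) (cassini h) ⟨
      d (suc i) * s (suc j) + (r * r + p * r) * (d i * s j) + p * p * (d j * s i)
        ≡⟨ solve 6 (λ p r d s d′ s′ →
             P.d⁺ p r d s :* P.s⁺ p r d′ s′ :+ (r :* r :+ p :* r) :* (d :* s′) :+ p :* p :* (d′ :* s) :=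
             P.d⁺ p r d′ s′ :* P.s⁺ p r d s :+ (r :* r :+ p :* r) :* (d′ :* s) :+ p :* p :* (d :* s′))
             refl p r (d i) (s i) (d j) (s j) ⟩
      d (suc j) * s (suc i) + (r * r + p * r) * (d j * s i) + p * p * (d i * s j)
        ≡⟨ cong (λ z → d (suc j) * s (suc i) + z * (d j * s i) + p * p * (d i * s j)) (cassini h) ⟩
      d (suc j) * s (suc i) + (p * p + 1) * (d j * s i) + p * p * (d i * s j)
        ≡⟨ solve 4 (λ x u v pp → x :+ (pp :+ con 1) :* v :+ pp :* u := x :+ v :+ pp :* (u :+ v)) refl (d (suc j) * s (suc i)) (d i * s j) (d j * s i) (p * p) ⟩
      d (suc j) * s (suc i) + d j * s i + p * p * (d i * s j + d j * s i) ∎)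
      where open ≡-Reasoning

    -- By `cross-step` the equation descends from i + 1 and j + 1 to i and j. When exactly one index
    -- has reached 0, it fails: `s` vanishes at 0 only, and `d` is 1 there.
    cross-injective : ∀ i j → d i * s j ≡ d j * s i → i ≡ j
    cross-injective zero    zero    _  = refl
    cross-injective zero    (suc j) eq = contradiction (trans (sym (*-identityˡ (s (suc j)))) (trans eq (*-zeroʳ (d (suc j))))) (n>0⇒n≢0 (0<s j))
    cross-injective (suc i) zero    eq = contradiction (trans (sym (*-identityˡ (s (suc i)))) (trans (sym eq) (*-zeroʳ (d (suc i))))) (n>0⇒n≢0 (0<s i))
    cross-injective (suc i) (suc j) eq = cong suc (cross-injective i j
      (+-cancelˡ-≡ (d (suc i) * s (suc j)) _ _ (trans (cross-step i j) (cong (_+ d j * s i) (sym eq)))))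

    C f′ H′ : ℕ → ℕ
    C j = Mat.C (period p r (d j) (s j))
    f′ j = f p r (d j) (s j)
    H′ j = H p r (d j) (s j)

    -- All summands are natural numbers, and 816 r⁵ d d′ is a positive one.
    0<M : ∀ i j → 0 < M p r (d i) (s i) (d j) (s j)
    0<M i j = ≤-trans (*-mono-≤ 0<m₀₁ (*-mono-≤ (0<d i) (0<d j))) (m≤m+n _ _)
      where
      0<r⁵ : 0 < r * r * r * r * r
      0<r⁵ = *-mono-≤ (*-mono-≤ (*-mono-≤ (*-mono-≤ (0<R h) (0<R h)) (0<R h)) (0<R h)) (0<R h)
      0<m₀₁ : 0 < m₀₁ p r
      0<m₀₁ = ≤-trans (≤-trans 0<r⁵ (m≤n*m _ 816)) (m≤m+n _ _)

    -- The slope is (A - D) / C. If two slopes agree, `cross-product` leaves an equation between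
    -- multiples of `d i * s j` and `d j * s i` by the same positive M.
    slope-injective : ∀ i j → H′ i * C j ≡ H′ j * C i → i ≡ j
    slope-injective i j eq = cross-injective i j (*-cancelˡ-≡ (d i * s j) (d j * s i) m {{>-nonZero (0<M i j)}}
      (+-cancelˡ-≡ (H′ i * C j) _ _ (trans (cross-product p r (d i) (s i) (d j) (s j)) (cong (_+ m * (d j * s i)) (sym eq)))))
      where m = M p r (d i) (s i) (d j) (s j)

    0<f : ∀ j → 0 < f′ j
    0<f j = *-mono-≤ (*-mono-≤ {1} {4} (s≤s z≤n) (≤-trans (0<d (suc j)) (m≤m+n _ _))) (0<s j)

  -- The sum B + D carries the induction, because B is 0 for the empty word and D is 0 for a word of
  -- one letter.
  matrix-positive : ∀ {w} → All OneOrTwo w → let open Mat (matrix w) in 0 < A × 0 < B + D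
  matrix-positive [] = s≤s z≤n , s≤s z≤n
  matrix-positive {x ∷ w} (x12 ∷ w12) =
    ≤-trans 0<A (≤-trans (≤-x* A) (m≤m+n (x * A) C)) ,
    ≤-trans 0<B+D (≤-trans (+-monoˡ-≤ D (≤-x* B)) (m≤m+n (x * B + D) B))
    where
    open Mat (matrix w)
    0<A = proj₁ (matrix-positive w12)
    0<B+D = proj₂ (matrix-positive w12)
    0<x : ∀ {x} → OneOrTwo x → 0 < x
    0<x (inj₁ refl) = s≤s z≤n
    0<x (inj₂ refl) = s≤s z≤n
    ≤-x* : ∀ n → n ≤ x * n
    ≤-x* n = m≤n*m n x {{>-nonZero (0<x x12)}}

-- Pairwise coprime discriminants from the divisibility of Fibonacci numbers.

module Discriminants where
  open import Data.Nat.Base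
  open import Data.Nat.Properties
  open import Data.Nat.Solver using (module +-*-Solver)
  open import Relation.Binary.Definitions using (tri<; tri≈; tri>)
  open +-*-Solver
  open Words
  open Formulas _+_ _*_ id hiding (b)

  fib : ℕ → ℕ
  fib zero          = 0
  fib (suc zero)    = 1
  fib (suc (suc n)) = fib (suc n) + fib n

  fib-+ : ∀ m n → fib (suc (m + n)) ≡ fib (suc m) * fib (suc n) + fib m * fib n
  fib-+ zero    n = sym (trans (+-identityʳ _) (*-identityˡ _))
  fib-+ (suc m) n = begin
    fib (suc (suc m + n))                                   ≡⟨ cong (fib ∘ suc) (+-suc m n) ⟨
    fib (suc (m + suc n))                                   ≡⟨ fib-+ m (suc n) ⟩
    fib (suc m) * (fib (suc n) + fib n) + fib m * fib (suc n)
      ≡⟨ solve 4 (λ a b c d → a :* (c :+ d) :+ b :* c := (a :+ b) :* c :+ a :* d) refl (fib (suc m)) (fib m) (fib (suc n)) (fib n) ⟩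
    fib (suc (suc m)) * fib (suc n) + fib (suc m) * fib n   ∎
    where open ≡-Reasoning

  fib-∣ : ∀ {m n} → m ∣ n → fib m ∣ fib n
  fib-∣ {m} {n} (divides k eq) = subst (λ x → fib m ∣ fib x) (sym eq) (multiple m k)
    where
    multiple : ∀ m k → fib m ∣ fib (k * m)
    multiple zero    k       = subst (λ n → 0 ∣ fib n) (sym (*-zeroʳ k)) ∣-refl
    multiple (suc m) zero    = _ ∣0
    multiple (suc m) (suc k) = subst (fib (suc m) ∣_) (sym (fib-+ m (k * suc m)))
      (∣m∣n⇒∣m+n (m∣m*n _) (∣-trans (multiple (suc m) k) (n∣m*n (fib m))))

  fib-PR : ∀ h → fib (h * 2) ≡ P h × fib (1 + h * 2) ≡ P h + R h
  fib-PR zero    = refl , refl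
  fib-PR (suc h) = F₂ , F₃
    where
    F₀ = proj₁ (fib-PR h)
    F₁ = proj₂ (fib-PR h)
    F₂ : fib (2 + h * 2) ≡ P (suc h)
    F₂ = trans (cong₂ _+_ F₁ F₀) (solve 2 (λ p r → p :+ r :+ p := con 2 :* p :+ r) refl (P h) (R h))
    F₃ : fib (3 + h * 2) ≡ P (suc h) + R (suc h)
    F₃ = cong₂ _+_ F₂ F₁

  fib-t : ∀ h → fib (4 + h * 2) ≡ t (P h) (R h)
  fib-t h = trans (proj₁ (fib-PR (2 + h)))
    (solve 2 (λ p r → con 2 :* (con 2 :* p :+ r) :+ (p :+ r) := P.t p r) refl (P h) (R h))

  fib-δ : ∀ h → fib (3 + h * 2) * fib (5 + h * 2) ≡ δ (P h) (R h)
  fib-δ h = trans (cong₂ _*_ (proj₂ (fib-PR (1 + h))) (proj₂ (fib-PR (2 + h))))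
    (solve 2 (λ p r → let p′ = con 2 :* p :+ r; r′ = p :+ r in
       (p′ :+ r′) :* (con 2 :* p′ :+ r′ :+ (p′ :+ r′)) := P.δ p r) refl (P h) (R h))

  -- Chosen so that 4 + 2 (next h) = (3 + 2h) (4 + 2h) (5 + 2h).
  next : ℕ → ℕ
  next h = 28 + 47 * h + 24 * (h * h) + 4 * (h * h * h)

  index : ℕ → ℕ
  index zero    = 0
  index (suc i) = next (index i)

  -- The index k + 4 at which `tᵢ` is a Fibonacci number; `δᵢ` is the product of the two
  -- neighbouring Fibonacci numbers.
  N : ℕ → ℕ
  N i = 4 + index i * 2

  N-suc : ∀ i → N (suc i) ≡ N i * ((3 + index i * 2) * (5 + index i * 2))
  N-suc i = solve 1 (λ h →
    con 4 :+ (con 28 :+ con 47 :* h :+ con 24 :* (h :* h) :+ con 4 :* (h :* h :* h)) :* con 2 :=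
    (con 4 :+ h :* con 2) :* ((con 3 :+ h :* con 2) :* (con 5 :+ h :* con 2))) refl (index i)

  -- The product of the neighbours of `N i` is a factor of `N (suc i)` by the choice of `next`, and
  -- every `N j` divides its successor.
  neighbours∣N : ∀ {i j} → i < j → (3 + index i * 2) * (5 + index i * 2) ∣ N j
  neighbours∣N {i} {suc j} (s≤s i≤j) with m≤n⇒m<n∨m≡n i≤j
  ... | inj₁ i<j  = ∣-trans (neighbours∣N i<j) (subst (N j ∣_) (sym (N-suc j)) (m∣m*n ((3 + index j * 2) * (5 + index j * 2))))
  ... | inj₂ refl = divides (N i) (N-suc i)

  δᵢ tᵢ : ℕ → ℕ
  δᵢ i = δ (P (index i)) (R (index i))
  tᵢ i = t (P (index i)) (R (index i))

  -- `δᵢ i` is a product of two Fibonacci numbers whose indices divide `N j`. Each of them divides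
  -- one copy of `tᵢ j`, by `fib-∣`.
  δ∣t² : ∀ {i j} → i < j → δᵢ i ∣ tᵢ j * tᵢ j
  δ∣t² {i} {j} i<j = subst₂ _∣_ (fib-δ (index i)) (cong₂ _*_ (fib-t (index j)) (fib-t (index j)))
    (*-pres-∣ Fa∣ Fb∣)
    where
    a = 3 + index i * 2
    b = 5 + index i * 2
    a*b∣N : a * b ∣ N j
    a*b∣N = neighbours∣N i<j
    Fa∣ : fib a ∣ fib (N j)
    Fa∣ = fib-∣ {a} {N j} (∣-trans (m∣m*n b) a*b∣N)
    Fb∣ : fib b ∣ fib (N j)
    Fb∣ = fib-∣ {b} {N j} (∣-trans (n∣m*n a) a*b∣N)

  -- A common divisor divides both `tᵢ j * tᵢ j` and its successor.
  δ-coprime-< : ∀ {i j} → i < j → Coprime (δᵢ i) (δᵢ j)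
  δ-coprime-< {i} {j} i<j {e} (e∣δᵢ , e∣δⱼ) =
    ∣1⇒≡1 (∣m+n∣m⇒∣n {m = tᵢ j * tᵢ j} (subst (e ∣_) (δ≡t²+1 (index j)) e∣δⱼ)
      (∣-trans e∣δᵢ (δ∣t² {i} {j} i<j)))

  δ-coprime : ∀ {i j} → i ≢ j → Coprime (δᵢ i) (δᵢ j)
  δ-coprime {i} {j} i≢j with <-cmp i j
  ... | tri< i<j _ _ = δ-coprime-< {i} {j} i<j
  ... | tri≈ _ i≡j _ = contradiction i≡j i≢j
  ... | tri> _ _ j<i = ℕ.sym (δ-coprime-< {j} {i} j<i)

-- Limits of rational sequences, quadratic irrationals and values of continued fractions.

module Limits where
  open import Data.Integer.Base as ℤ using (+_; +[1+_]; -[1+_]; +0)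
  import Data.Integer.Properties as ℤ
  open import Data.Rational.Base
  open import Data.Rational.Properties
  import Data.Rational.Solver as ℚ-Solver
  import Data.Rational.Unnormalised.Base as ℚᵘ
  import Data.Rational.Unnormalised.Properties as ℚᵘ
  open import Data.Fin.Base using (Fin; fromℕ<)
  open import Data.Fin.Properties using (fromℕ<-cong)
  open import Data.List.Membership.Propositional.Properties using (∈-lookup)
  open import Data.Nat.DivMod using (_%_; _mod_; m%n<n; m<n⇒m%n≡m; [m+n]%n≡m%n)
  open ℚ-Solver.+-*-Solver using (solve; _:=_; _:+_; _:*_; _:-_; :-_; con)
  open Words using (Mat; mat; matrix; OneOrTwo; _++ˢ_; module Period; matrix-positive; A≡H+D; discriminant; module Formulas)

  -- Rational arithmetic

  ι : ℕ → ℚ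
  ι n = + n / 1

  -- For a variable n the quotient `+ n / 1` is stuck on a gcd; in constructor form its numerator
  -- and denominator compute.
  ι-mkℚ : ∀ n → ι n ≡ mkℚ (+ n) 0 (ℕ.sym (ℕ.1-coprimeTo n))
  ι-mkℚ n = normalize-coprime (ℕ.sym (ℕ.1-coprimeTo n))

  ι-+ : ∀ m n → ι (m ℕ.+ n) ≡ ι m + ι n
  ι-+ m n = sym (trans (cong₂ _+_ (ι-mkℚ m) (ι-mkℚ n))
    (cong (_/ 1) (cong₂ ℤ._+_ (ℤ.*-identityʳ (+ m)) (ℤ.*-identityʳ (+ n)))))

  ι-* : ∀ m n → ι (m ℕ.* n) ≡ ι m * ι n
  ι-* m n = sym (trans (cong₂ _*_ (ι-mkℚ m) (ι-mkℚ n)) (cong (_/ 1) (sym (ℤ.pos-* m n))))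

  ι-*+ : ∀ x a c → ι (x ℕ.* a ℕ.+ c) ≡ ι x * ι a + ι c
  ι-*+ x a c = trans (ι-+ (x ℕ.* a) c) (cong (_+ ι c) (ι-* x a))

  ι-mono-≤ : ∀ {m n} → m ℕ.≤ n → ι m ≤ ι n
  ι-mono-≤ {m} {n} m≤n = subst₂ _≤_ (sym (ι-mkℚ m)) (sym (ι-mkℚ n))
    (*≤* (ℤ.*-monoʳ-≤-nonNeg (+ 1) (ℤ.+≤+ m≤n)))

  ι-injective : ∀ {m n} → ι m ≡ ι n → m ≡ n
  ι-injective {m} {n} eq =
    ℤ.+-injective (cong ↥_ (trans (sym (ι-mkℚ m)) (trans eq (ι-mkℚ n))))

  0≤ι : ∀ n → 0ℚ ≤ ι n
  0≤ι n = ι-mono-≤ {0} {n} ℕ.z≤n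

  -- The Archimedean property: the denominator is at least 1.
  ≤-ι∣↥∣ : ∀ p → p ≤ ι ℤ.∣ ↥ p ∣
  ≤-ι∣↥∣ p@(mkℚ (+ n) d _) = subst (p ≤_) (sym (ι-mkℚ n))
    (*≤* (ℤ.*-monoˡ-≤-nonNeg (+ n) (ℤ.+≤+ (ℕ.s≤s ℕ.z≤n))))
  ≤-ι∣↥∣ p@(mkℚ -[1+ n ] d _) =
    ≤-trans (<⇒≤ (negative⁻¹ p)) (0≤ι (suc n))

  0<⇒≢0 : ∀ {p} → 0ℚ < p → p ≢ 0ℚ
  0<⇒≢0 0<p p≡0 = <⇒≢ 0<p (sym p≡0)

  *-monoʳ : ∀ {p q r} → 0ℚ ≤ r → p ≤ q → p * r ≤ q * r
  *-monoʳ {r = r} 0≤r = *-monoʳ-≤-nonNeg r {{nonNegative 0≤r}}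

  *-monoˡ : ∀ {p q r} → 0ℚ ≤ r → p ≤ q → r * p ≤ r * q
  *-monoˡ {r = r} 0≤r = *-monoˡ-≤-nonNeg r {{nonNegative 0≤r}}

  ≤-*ʳ : ∀ {p q} → 0ℚ ≤ p → 1ℚ ≤ q → p ≤ p * q
  ≤-*ʳ {p} {q} 0≤p 1≤q = subst (_≤ p * q) (*-identityʳ p) (*-monoˡ 0≤p 1≤q)

  2ℚ 3ℚ 4ℚ : ℚ
  2ℚ = 1ℚ + 1ℚ
  3ℚ = 2ℚ + 1ℚ
  4ℚ = 2ℚ + 2ℚ

  0≤1 : 0ℚ ≤ 1ℚ
  0≤1 = nonNegative⁻¹ 1ℚ

  0<1 : 0ℚ < 1ℚ
  0<1 = positive⁻¹ 1ℚ

  ≤∣∣ : ∀ p → p ≤ ∣ p ∣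
  ≤∣∣ p with ∣p∣≡p∨∣p∣≡-p p
  ... | inj₁ eq = ≤-reflexive (sym eq)
  ... | inj₂ eq with ≤-total 0ℚ p
  ...   | inj₁ 0≤p = ≤-reflexive (sym (0≤p⇒∣p∣≡p 0≤p))
  ...   | inj₂ p≤0 = ≤-trans p≤0 (0≤∣p∣ p)

  ≤∧≢⇒< : ∀ {p q} → p ≤ q → p ≢ q → p < q
  ≤∧≢⇒< p≤q p≢q = ≰⇒> (p≢q ∘ ≤-antisym p≤q)

  *-nonzero : ∀ {p q} → p ≢ 0ℚ → p * q ≡ 0ℚ → q ≡ 0ℚ
  *-nonzero {p} {q} p≢0 pq≡0 = begin
    q              ≡⟨ *-identityˡ q ⟨
    1ℚ * q         ≡⟨ cong (_* q) (*-inverseˡ p) ⟨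
    1/ p * p * q   ≡⟨ *-assoc (1/ p) p q ⟩
    1/ p * (p * q) ≡⟨ cong (1/ p *_) pq≡0 ⟩
    1/ p * 0ℚ      ≡⟨ *-zeroʳ (1/ p) ⟩
    0ℚ             ∎
    where
    open ≡-Reasoning
    instance _ = ≢-nonZero p≢0

  p-q≡0⇒p≡q : ∀ {p q} → p - q ≡ 0ℚ → p ≡ q
  p-q≡0⇒p≡q {p} {q} eq = trans (CauchyProperties.insert p q) (trans (cong (_+_ q) eq) (+-identityʳ q))

  -- Sequences tending to zero

  Null : (ℕ → ℚ) → Set
  Null z = ∀ ε → 0ℚ < ε → ∃[ N ] ∀ n → N ℕ.≤ n → ∣ z n ∣ < ε

  open CauchyProperties using (half; half+half; max-≤ˡ; max-≤ʳ; bounded; shrink; scaled)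

  null-cong : ∀ {y z} → (∀ n → y n ≡ z n) → Null y → Null z
  null-cong eq ny ε 0<ε with ny ε 0<ε
  ... | N , p = N , λ n n≥ → subst (λ t → ∣ t ∣ < ε) (eq n) (p n n≥)

  null-0 : Null (λ _ → 0ℚ)
  null-0 ε 0<ε = 0 , λ _ _ → 0<ε

  null-+ : ∀ {y z} → Null y → Null z → Null (λ n → y n + z n)
  null-+ {y} {z} ny nz ε 0<ε with ny (½ * ε) (half 0<ε) | nz (½ * ε) (half 0<ε)
  ... | M , p | N , q = M ℕ.⊔ N , λ n n≥ →
    ≤-<-trans (∣p+q∣≤∣p∣+∣q∣ (y n) (z n))
      (subst (∣ y n ∣ + ∣ z n ∣ <_) (half+half ε)
        (+-mono-< (p n (max-≤ˡ M N n≥)) (q n (max-≤ʳ M N n≥))))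

  -- The factor is taken to be a real number because a Cauchy sequence is eventually bounded.
  null-* : ∀ {z} (b : ℝ) → Null z → Null (λ n → seq b n * z n)
  null-* {z} b nz ε 0<ε =
    let B , B>0 , M , b≤B = bounded (cauchy b)
        δ , 0<δ , Bδ≡ = shrink B B>0 ε 0<ε
        N , p = nz δ 0<δ
    in M ℕ.⊔ N , λ n n≥ →
       <-trans (subst (∣ seq b n * z n ∣ <_) Bδ≡
                  (scaled B B>0 {seq b n} (b≤B n (max-≤ˡ M N n≥)) (p n (max-≤ʳ M N n≥))))
               (subst (½ * ε <_) (*-identityˡ ε)
                  (*-monoˡ-<-pos ε {{positive 0<ε}} {½} {1ℚ} (*<* (ℤ.+<+ (ℕ.s≤s (ℕ.s≤s ℕ.z≤n))))))

  null-scale : ∀ {z} c → Null z → Null (λ n → c * z n)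
  null-scale c = null-* (fromℚ c)

  -- Taking ε = ∣ c ∣ refutes c ≢ 0. This is how limits are turned into exact equations between
  -- rationals.
  null-const : ∀ {c} → Null (λ _ → c) → c ≡ 0ℚ
  null-const {c} nc with c ≟ 0ℚ
  ... | yes c≡0 = c≡0
  ... | no c≢0 with nc ∣ c ∣ (≤∧≢⇒< (0≤∣p∣ c) (c≢0 ∘ ∣p∣≡0⇒p≡0 c ∘ sym))
  ...   | N , p = contradiction (p N ℕ.≤-refl) (<-irrefl refl)

  -- Iterating the hypothesis gives ι m * ∣ z n ∣ ≤ K for n ≥ m * N.
  null-halving : ∀ {z} K N → (∀ n → ∣ z n ∣ ≤ K) →
                 (∀ n → 2ℚ * ∣ z (N ℕ.+ n) ∣ ≤ ∣ z n ∣) → Null z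
  null-halving {z} K N z≤K halve ε 0<ε = m ℕ.* N , λ n n≥ →
    *-cancelˡ-<-nonNeg (ι m) {{nonNegative (0≤ι m)}}
      (≤-<-trans (decay m′ n n≥) K<mε)
    where
    open ≤-Reasoning
    instance
      _ = positive 0<ε
      _ = pos⇒nonZero ε
    -- K / ε is at most m′, so K is less than (m′ + 1) ε.
    m′ = ℤ.∣ ↥ (K * 1/ ε) ∣
    m = suc m′
    K<mε : K < ι m * ε
    K<mε = begin-strict
      K                ≡⟨ *-identityʳ K ⟨
      K * 1ℚ           ≡⟨ cong (K *_) (*-inverseˡ ε) ⟨
      K * (1/ ε * ε)   ≡⟨ *-assoc K (1/ ε) ε ⟨
      K * 1/ ε * ε     ≤⟨ *-monoʳ (<⇒≤ 0<ε) (≤-ι∣↥∣ (K * 1/ ε)) ⟩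
      ι m′ * ε         ≡⟨ +-identityˡ (ι m′ * ε) ⟨
      0ℚ + ι m′ * ε    <⟨ +-monoˡ-< (ι m′ * ε) 0<ε ⟩
      ε + ι m′ * ε     ≡⟨ cong (_+ ι m′ * ε) (*-identityˡ ε) ⟨
      1ℚ * ε + ι m′ * ε ≡⟨ *-distribʳ-+ ε 1ℚ (ι m′) ⟨
      (1ℚ + ι m′) * ε   ≡⟨ cong (_* ε) (ι-+ 1 m′) ⟨
      ι m * ε           ∎
    decay : ∀ k n → suc k ℕ.* N ℕ.≤ n → ι (suc k) * ∣ z n ∣ ≤ K
    decay zero n _ = subst (_≤ K) (sym (*-identityˡ ∣ z n ∣)) (z≤K n)
    decay (suc k) n n≥ = begin
      -- A shift by N allows the factor to double; growing it by 1 is enough, since 2 + k ≤ 2 (1 +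
      -- k).
      ι (2 ℕ.+ k) * ∣ z n ∣                     ≤⟨ *-monoʳ (0≤∣p∣ (z n)) (ι-mono-≤ 2+k≤) ⟩
      ι (2 ℕ.* suc k) * ∣ z n ∣                 ≡⟨ cong (λ t → ι (2 ℕ.* suc k) * ∣ z t ∣) (sym (ℕ.m+[n∸m]≡n N≤n)) ⟩
      ι (2 ℕ.* suc k) * ∣ z (N ℕ.+ n′) ∣        ≡⟨ cong (_* ∣ z (N ℕ.+ n′) ∣) (trans (ι-* 2 (suc k)) (*-comm (ι 2) (ι (suc k)))) ⟩
      ι (suc k) * ι 2 * ∣ z (N ℕ.+ n′) ∣        ≡⟨ *-assoc (ι (suc k)) (ι 2) ∣ z (N ℕ.+ n′) ∣ ⟩
      ι (suc k) * (ι 2 * ∣ z (N ℕ.+ n′) ∣)      ≤⟨ *-monoˡ (0≤ι (suc k)) (halve n′) ⟩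
      ι (suc k) * ∣ z n′ ∣                      ≤⟨ decay k n′ n′≥ ⟩
      K                                         ∎
      where
      n′ = n ℕ.∸ N
      N≤n : N ℕ.≤ n
      N≤n = ℕ.≤-trans (ℕ.m≤m+n N _) n≥
      n′≥ : suc k ℕ.* N ℕ.≤ n′
      n′≥ = subst (ℕ._≤ n′) (ℕ.m+n∸m≡n N (suc k ℕ.* N)) (ℕ.∸-monoˡ-≤ N n≥)
      2+k≤ : 2 ℕ.+ k ℕ.≤ 2 ℕ.* suc k
      2+k≤ = ℕ.m<m+n (suc k) (ℕ.s≤s ℕ.z≤n)

  -- Square roots of integers

  -- Let d divide both squares. A common divisor of d and a is coprime to b and divides b², so it is
  -- 1. Hence d is coprime to a, yet divides a².
  coprime-square : ∀ {a b} → Coprime a b → Coprime (a ℕ.* a) (b ℕ.* b)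
  coprime-square {a} {b} a⊥b {d} (d∣aa , d∣bb) = d⊥a (∣-refl , coprime-divisor d⊥a d∣aa)
    where
    d⊥a : Coprime d a
    d⊥a {e} (e∣d , e∣a) = a⊥b (e∣a , coprime-divisor e⊥b (∣-trans e∣d d∣bb))
      where
      e⊥b : Coprime e b
      e⊥b (f∣e , f∣b) = a⊥b (∣-trans f∣e e∣a , f∣b)

  -- The proof passes through unnormalised rationals, where products are not reduced, and takes
  -- absolute values to remove the sign of r.
  clear-denominators : ∀ r m n → r * r * ι m ≡ ι n →
    ℤ.∣ ↥ r ∣ ℕ.* ℤ.∣ ↥ r ∣ ℕ.* m ≡ n ℕ.* (↧ₙ r ℕ.* ↧ₙ r)
  clear-denominators r@(mkℚ a d _) m n eq = begin
    ℤ.∣ a ∣ ℕ.* ℤ.∣ a ∣ ℕ.* m                     ≡⟨ cong (ℕ._* m) (ℤ.abs-* a a) ⟨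
    ℤ.∣ a ℤ.* a ∣ ℕ.* m                           ≡⟨ ℤ.abs-* (a ℤ.* a) (+ m) ⟨
    ℤ.∣ a ℤ.* a ℤ.* + m ∣                         ≡⟨ cong ℤ.∣_∣ (trans (sym (ℤ.*-identityʳ (a ℤ.* a ℤ.* + m))) (ℚᵘ.drop-*≡* eqᵘ)) ⟩
    ℤ.∣ + n ℤ.* + (suc d ℕ.* suc d ℕ.* 1) ∣       ≡⟨ ℤ.abs-* (+ n) (+ (suc d ℕ.* suc d ℕ.* 1)) ⟩
    n ℕ.* (suc d ℕ.* suc d ℕ.* 1)                 ≡⟨ cong (n ℕ.*_) (ℕ.*-identityʳ (suc d ℕ.* suc d)) ⟩
    n ℕ.* (suc d ℕ.* suc d)                       ∎
    where
    open ≡-Reasoning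
    eqᵘ : (toℚᵘ r ℚᵘ.* toℚᵘ r) ℚᵘ.* ℚᵘ.mkℚᵘ (+ m) 0 ℚᵘ.≃ ℚᵘ.mkℚᵘ (+ n) 0
    eqᵘ = ℚᵘ.≃-trans (ℚᵘ.≃-sym (ℚᵘ.*-cong (toℚᵘ-homo-* r r) (toℚᵘ-cong (ι-mkℚ m))))
      (ℚᵘ.≃-trans (ℚᵘ.≃-sym (toℚᵘ-homo-* (r * r) (ι m))) (toℚᵘ-cong (trans eq (ι-mkℚ n))))

  lowest-terms : ∀ r → Coprime ℤ.∣ ↥ r ∣ (↧ₙ r)
  lowest-terms (mkℚ _ _ c) = ℕ.recompute c

  -- If r = a / b in lowest terms, then b divides a² and is coprime to a, so b = 1 and δ = a².
  sqrt-irrational : ∀ {δ} → NonSquare δ → ∀ r → r * r ≢ ι δ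
  sqrt-irrational {δ} nonsq r rr≡δ = nonsq (a , (begin
    a ℕ.* a         ≡⟨ aa≡ ⟩
    δ ℕ.* (b ℕ.* b) ≡⟨ cong (λ t → δ ℕ.* (t ℕ.* t)) b≡1 ⟩
    δ ℕ.* 1         ≡⟨ ℕ.*-identityʳ δ ⟩
    δ               ∎))
    where
    open ≡-Reasoning
    a = ℤ.∣ ↥ r ∣
    b = ↧ₙ r
    aa≡ : a ℕ.* a ≡ δ ℕ.* (b ℕ.* b)
    aa≡ = trans (sym (ℕ.*-identityʳ (a ℕ.* a)))
      (clear-denominators r 1 δ (trans (*-identityʳ (r * r)) rr≡δ))
    b∣aa : b ∣ a ℕ.* a
    b∣aa = subst (b ∣_) (sym aa≡) (∣-trans (m∣m*n b) (n∣m*n δ))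
    b≡1 : b ≡ 1
    b≡1 = lowest-terms r (coprime-divisor (ℕ.sym (lowest-terms r)) b∣aa , ∣-refl)

  -- Let r = a / b in lowest terms, so a² δ′ = δ b². Coprimality gives a² = α δ and b² = β δ′, and
  -- cancelling δ δ′ gives α = β. This common divisor of the coprime a² and b² is 1, so δ′ would be
  -- the square b².
  square-ratio-irrational : ∀ {δ δ′} → NonSquare δ → NonSquare δ′ → Coprime δ δ′ →
                            ∀ r → r * r * ι δ′ ≢ ι δ
  square-ratio-irrational {δ} {δ′} nonsq nonsq′ δ⊥δ′ r eq = nonsq′ (b , (begin
    b ℕ.* b    ≡⟨ bb≡βδ′ ⟩
    β ℕ.* δ′   ≡⟨ cong (ℕ._* δ′) (trans β≡α α≡1) ⟩
    1 ℕ.* δ′   ≡⟨ ℕ.*-identityˡ δ′ ⟩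
    δ′         ∎))
    where
    open ≡-Reasoning
    a = ℤ.∣ ↥ r ∣
    b = ↧ₙ r
    aaδ′≡δbb : a ℕ.* a ℕ.* δ′ ≡ δ ℕ.* (b ℕ.* b)
    aaδ′≡δbb = clear-denominators r δ′ δ eq
    δ∣aa : δ ∣ a ℕ.* a
    δ∣aa = coprime-divisor δ⊥δ′
      (divides (b ℕ.* b) (trans (ℕ.*-comm δ′ _) (trans aaδ′≡δbb (ℕ.*-comm δ _))))
    δ′∣bb : δ′ ∣ b ℕ.* b
    δ′∣bb = coprime-divisor (ℕ.sym δ⊥δ′) (divides (a ℕ.* a) (sym aaδ′≡δbb))
    open _∣_ δ∣aa using () renaming (quotient to α; equality to aa≡αδ)
    open _∣_ δ′∣bb using () renaming (quotient to β; equality to bb≡βδ′)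
    δδ′≢0 : ℕ.NonZero (δ ℕ.* δ′)
    δδ′≢0 = ℕ.m*n≢0 δ δ′ {{ℕ.≢-nonZero λ δ≡0 → nonsq (0 , sym δ≡0)}}
                         {{ℕ.≢-nonZero λ δ′≡0 → nonsq′ (0 , sym δ′≡0)}}
    β≡α : β ≡ α
    β≡α = ℕ.*-cancelʳ-≡ β α (δ ℕ.* δ′) {{δδ′≢0}} (begin
      β ℕ.* (δ ℕ.* δ′)   ≡⟨ cong (β ℕ.*_) (ℕ.*-comm δ δ′) ⟩
      β ℕ.* (δ′ ℕ.* δ)   ≡⟨ ℕ.*-assoc β δ′ δ ⟨
      β ℕ.* δ′ ℕ.* δ     ≡⟨ cong (ℕ._* δ) bb≡βδ′ ⟨
      b ℕ.* b ℕ.* δ      ≡⟨ ℕ.*-comm (b ℕ.* b) δ ⟩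
      δ ℕ.* (b ℕ.* b)    ≡⟨ aaδ′≡δbb ⟨
      a ℕ.* a ℕ.* δ′     ≡⟨ cong (ℕ._* δ′) aa≡αδ ⟩
      α ℕ.* δ ℕ.* δ′     ≡⟨ ℕ.*-assoc α δ δ′ ⟩
      α ℕ.* (δ ℕ.* δ′)   ∎)
    α≡1 : α ≡ 1
    α≡1 = coprime-square (lowest-terms r)
      ( divides δ (trans aa≡αδ (ℕ.*-comm α δ))
      , divides δ′ (trans bb≡βδ′ (trans (cong (ℕ._* δ′) β≡α) (ℕ.*-comm α δ′))))

  irrational : ∀ {δ} → NonSquare δ → ∀ x y → x * x ≡ ι δ * (y * y) → y ≡ 0ℚ
  irrational {δ} nonsq x y eq with y ≟ 0ℚ
  ... | yes y≡0 = y≡0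
  ... | no y≢0 = contradiction sq (sqrt-irrational nonsq (x * 1/ y))
    where
    open ≡-Reasoning
    instance _ = ≢-nonZero y≢0
    sq : x * 1/ y * (x * 1/ y) ≡ ι δ
    sq = begin
      x * 1/ y * (x * 1/ y)              ≡⟨ solve 2 (λ x i → x :* i :* (x :* i) := x :* x :* (i :* i)) refl x (1/ y) ⟩
      x * x * (1/ y * 1/ y)              ≡⟨ cong (_* (1/ y * 1/ y)) eq ⟩
      ι δ * (y * y) * (1/ y * 1/ y)      ≡⟨ solve 3 (λ d y i → d :* (y :* y) :* (i :* i) := d :* (y :* i) :* (y :* i)) refl (ι δ) y (1/ y) ⟩
      ι δ * (y * 1/ y) * (y * 1/ y)      ≡⟨ cong₂ (λ s t → ι δ * s * t) (*-inverseʳ y) (*-inverseʳ y) ⟩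
      ι δ * 1ℚ * 1ℚ                      ≡⟨ trans (*-identityʳ (ι δ * 1ℚ)) (*-identityʳ (ι δ)) ⟩
      ι δ                                ∎

  -- Dividing the quadratic polynomial by the linear one leaves a constant
  -- remainder, which tends to zero along x.
  linear-null : ∀ (x : ℝ) c e g α β →
    Null (λ n → c * (seq x n * seq x n) + e * seq x n + g) → Null (λ n → α * seq x n + β) →
    (2ℚ * c * β - e * α) * (2ℚ * c * β - e * α) ≡ (e * e - 4ℚ * c * g) * (α * α)
  linear-null x c e g α β quad lin = begin
    (2ℚ * c * β - e * α) * (2ℚ * c * β - e * α)
      ≡⟨ solve 5 (λ c e g α β → (con 2ℚ :* c :* β :- e :* α) :* (con 2ℚ :* c :* β :- e :* α) :=
           (e :* e :- con 4ℚ :* c :* g) :* (α :* α)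
           :+ con 4ℚ :* c :* (α :* α :* g :- β :* (e :* α :- c :* β))) refl c e g α β ⟩
    (e * e - 4ℚ * c * g) * (α * α) + 4ℚ * c * (α * α * g - β * (e * α - c * β))
      ≡⟨ cong (λ t → (e * e - 4ℚ * c * g) * (α * α) + 4ℚ * c * t) (null-const remainder) ⟩
    (e * e - 4ℚ * c * g) * (α * α) + 4ℚ * c * 0ℚ
      ≡⟨ cong (_+_ ((e * e - 4ℚ * c * g) * (α * α))) (*-zeroʳ (4ℚ * c)) ⟩
    (e * e - 4ℚ * c * g) * (α * α) + 0ℚ
      ≡⟨ +-identityʳ _ ⟩
    (e * e - 4ℚ * c * g) * (α * α) ∎
    where
    open ≡-Reasoning
    quotient : ℝ
    quotient = fromℚ (- (c * α)) *ℝ x +ℝ fromℚ (c * β - e * α)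
    remainder : Null (λ _ → α * α * g - β * (e * α - c * β))
    remainder = null-cong
      (λ n → solve 6 (λ c e g α β x →
          α :* α :* (c :* (x :* x) :+ e :* x :+ g)
          :+ (:- (c :* α) :* x :+ (c :* β :- e :* α)) :* (α :* x :+ β)
          := α :* α :* g :- β :* (e :* α :- c :* β)) refl c e g α β (seq x n))
      (null-+ (null-scale (α * α) quad) (null-* quotient lin))

  -- By `linear-null`, δ (f α)² is the square of a rational, so irrationality of √δ forces f α = 0.
  linear-trivial : ∀ {δ} → NonSquare δ → ∀ (x : ℝ) c e g α β f → f ≢ 0ℚ →
    e * e - 4ℚ * c * g ≡ ι δ * (f * f) →
    Null (λ n → c * (seq x n * seq x n) + e * seq x n + g) →
    Null (λ n → α * seq x n + β) → α ≡ 0ℚ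
  linear-trivial {δ} nonsq x c e g α β f f≢0 disc quad lin =
    *-nonzero f≢0 (irrational nonsq (2ℚ * c * β - e * α) (f * α) (begin
      (2ℚ * c * β - e * α) * (2ℚ * c * β - e * α) ≡⟨ linear-null x c e g α β quad lin ⟩
      (e * e - 4ℚ * c * g) * (α * α)              ≡⟨ cong (_* (α * α)) disc ⟩
      ι δ * (f * f) * (α * α)                     ≡⟨ solve 3 (λ d f a → d :* (f :* f) :* (a :* a) := d :* (f :* a :* (f :* a))) refl (ι δ) f α ⟩
      ι δ * (f * α * (f * α))                     ∎))
    where open ≡-Reasoning

  linear-trivial-sqrt : ∀ {δ} → NonSquare δ → ∀ (s : ℝ) → s *ℝ s ≃ℝ fromℕ δ →
    ∀ α β → Null (λ n → α * seq s n + β) → α ≡ 0ℚ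
  linear-trivial-sqrt {δ} nonsq s s²≃δ α β =
    -- The polynomial x² - δ has discriminant δ · 2².
    linear-trivial nonsq s 1ℚ 0ℚ (- ι δ) α β 2ℚ (λ ())
      (solve 1 (λ d → con 0ℚ :* con 0ℚ :- con 4ℚ :* con 1ℚ :* (:- d) := d :* (con 2ℚ :* con 2ℚ)) refl (ι δ))
      (null-cong (λ n → solve 2 (λ s d → s :* s :- d := con 1ℚ :* (s :* s) :+ con 0ℚ :* s :+ :- d) refl (seq s n) (ι δ)) s²≃δ′)
    where
    s²≃δ′ : Null (λ n → seq s n * seq s n - ι δ)
    s²≃δ′ = s²≃δ

  -- The square δ of √δ = p + q√δ′ is rational, hence so is 2pq√δ′.
  sqrt-coordinates : ∀ {δ δ′} → NonSquare δ′ → ∀ {s} → s *ℝ s ≃ℝ fromℕ δ → ℚ[√ δ′ ] s →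
                     ∃[ p ] ∃[ q ] p * q ≡ 0ℚ × p * p + q * q * ι δ′ ≡ ι δ
  sqrt-coordinates {δ} {δ′} nonsq′ {s} s²≃δ (s′ , s′²≃δ′ , p , q , s≃p+qs′) =
    p , q , *-nonzero {2ℚ} (λ ()) (trans (sym (*-assoc 2ℚ p q)) 2pq≡0) , p-q≡0⇒p≡q (null-const constant)
    where
    α = 2ℚ * p * q
    β = p * p + q * q * ι δ′ - ι δ
    y = fromℚ p +ℝ fromℚ q *ℝ s′
    s²-null : Null (λ n → seq s n * seq s n - ι δ)
    s²-null = s²≃δ
    s′²-null : Null (λ n → seq s′ n * seq s′ n - ι δ′)
    s′²-null = s′²≃δ′
    y-null : Null (λ n → seq s n - seq y n)
    y-null = s≃p+qs′
    -[s+y] : ℝ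
    -[s+y] = fromℚ (- 1ℚ) *ℝ (s +ℝ y)
    linear : Null (λ n → α * seq s′ n + β)
    -- The three null sequences are s² - δ, -(s² - y²) and -q² (s′² - δ′); their sum is y² - δ with
    -- q² s′² replaced by q² δ′.
    linear = null-cong (λ n → expand (seq s n) (seq s′ n) (ι δ) (ι δ′) p q)
      (null-+ (null-+ s²-null (null-* -[s+y] y-null)) (null-scale (- (q * q)) s′²-null))
      where
      expand : ∀ s s′ d d′ p q →
        s * s - d + - 1ℚ * (s + (p + q * s′)) * (s - (p + q * s′)) + - (q * q) * (s′ * s′ - d′)
        ≡ 2ℚ * p * q * s′ + (p * p + q * q * d′ - d)
      expand = solve 6 (λ s s′ d d′ p q →
          s :* s :- d :+ con (- 1ℚ) :* (s :+ (p :+ q :* s′)) :* (s :- (p :+ q :* s′))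
            :+ :- (q :* q) :* (s′ :* s′ :- d′)
          := con 2ℚ :* p :* q :* s′ :+ (p :* p :+ q :* q :* d′ :- d)) refl
    2pq≡0 : α ≡ 0ℚ
    2pq≡0 = linear-trivial-sqrt nonsq′ s′ s′²≃δ′ α β linear
    constant : Null (λ _ → β)
    constant = null-cong
      (λ n → trans (cong (λ t → t * seq s′ n + β) 2pq≡0)
        (solve 2 (λ s b → con 0ℚ :* s :+ b := b) refl (seq s′ n) β))
      linear

  -- One of p and q is 0. If it is q, then δ is a rational square; if it is p, then δ / δ′ is one.
  no-coordinates : ∀ {δ δ′} → NonSquare δ → NonSquare δ′ → Coprime δ δ′ →
                   ∀ p q → p * q ≡ 0ℚ → p * p + q * q * ι δ′ ≢ ι δ
  no-coordinates {δ} {δ′} nonsq nonsq′ δ⊥δ′ p q pq≡0 eq = q²δ′≢δ q²δ′≡δ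
    where
    open ≡-Reasoning
    q²δ′≢δ : q * q * ι δ′ ≢ ι δ
    q²δ′≢δ = square-ratio-irrational nonsq nonsq′ δ⊥δ′ q
    drop-q² : ∀ p d → p * p ≡ p * p + 0ℚ * 0ℚ * d
    drop-q² = solve 2 (λ p d → p :* p := p :* p :+ con 0ℚ :* con 0ℚ :* d) refl
    drop-p² : ∀ q d → q * q * d ≡ 0ℚ * 0ℚ + q * q * d
    drop-p² = solve 2 (λ q d → q :* q :* d := con 0ℚ :* con 0ℚ :+ q :* q :* d) refl
    q≢0 : q ≢ 0ℚ
    q≢0 q≡0 = sqrt-irrational nonsq p (begin
      p * p                    ≡⟨ drop-q² p (ι δ′) ⟩
      p * p + 0ℚ * 0ℚ * ι δ′   ≡⟨ cong (λ t → p * p + t * t * ι δ′) q≡0 ⟨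
      p * p + q * q * ι δ′     ≡⟨ eq ⟩
      ι δ                      ∎)
    p≡0 : p ≡ 0ℚ
    p≡0 = *-nonzero q≢0 (trans (*-comm q p) pq≡0)
    q²δ′≡δ : q * q * ι δ′ ≡ ι δ
    q²δ′≡δ = begin
      q * q * ι δ′             ≡⟨ drop-p² q (ι δ′) ⟩
      0ℚ * 0ℚ + q * q * ι δ′   ≡⟨ cong (λ t → t * t + q * q * ι δ′) p≡0 ⟨
      p * p + q * q * ι δ′     ≡⟨ eq ⟩
      ι δ                      ∎

  sqrt∈ℚ[√] : ∀ δ (s : ℝ) → s *ℝ s ≃ℝ fromℕ δ → ℚ[√ δ ] s
  sqrt∈ℚ[√] δ s s²≃δ = s , s²≃δ , 0ℚ , 1ℚ , null-cong (λ n → eq (seq s n)) null-0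
    where
    eq : ∀ t → 0ℚ ≡ t - (0ℚ + 1ℚ * t)
    eq = solve 1 (λ s → con 0ℚ := s :- (con 0ℚ :+ con 1ℚ :* s)) refl

  -- An inclusion would give √δ coordinates p + q√δ′. The real square root is an argument because
  -- its existence comes from a known element of the field.
  fields-differ : ∀ {δ δ′} → NonSquare δ → NonSquare δ′ → Coprime δ δ′ →
                  ∃[ s ] s *ℝ s ≃ℝ fromℕ δ → ¬ (ℚ[√ δ ] ⊆ ℚ[√ δ′ ])
  fields-differ {δ} {δ′} nonsq nonsq′ δ⊥δ′ (s , s²≃δ) incl =
    let p , q , pq≡0 , eq = sqrt-coordinates {δ} {δ′} nonsq′ {s} s²≃δ (incl {s} (sqrt∈ℚ[√] δ s s²≃δ))
    in no-coordinates nonsq nonsq′ δ⊥δ′ p q pq≡0 eq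

  -- Continued fractions

  convergent-cong : ∀ {f g : ℕ → ℕ} → (∀ i → f i ≡ g i) → ∀ n → convergent f n ≡ convergent g n
  convergent-cong eq zero    = cong ι (eq 0)
  convergent-cong eq (suc n) = cong₂ (λ a c → ι a + recip c) (eq 0) (convergent-cong (eq ∘ suc) n)

  recip-inverse : ∀ p → 0ℚ < p → recip p * p ≡ 1ℚ
  recip-inverse (mkℚ +0 _ _)         (*<* (ℤ.+<+ ()))
  recip-inverse p@(mkℚ +[1+ _ ] _ _) _ = *-inverseˡ p
  recip-inverse p@(mkℚ -[1+ _ ] _ _) _ = *-inverseˡ p

  -- The lower bound for the tail puts its reciprocal between 0 and 1, which yields the upper bound
  -- 3 = 2 + 1. It also keeps `recip` away from its default value.
  convergent-bounds : ∀ {a} → (∀ i → OneOrTwo (a i)) → ∀ n → 1ℚ ≤ convergent a n × convergent a n ≤ 3ℚ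
  convergent-bounds {a} a12 zero with a 0 | a12 0
  ... | _ | inj₁ refl = ≤-refl , *≤* (ℤ.+≤+ (ℕ.s≤s ℕ.z≤n))
  ... | _ | inj₂ refl = *≤* (ℤ.+≤+ (ℕ.s≤s ℕ.z≤n)) , *≤* (ℤ.+≤+ (ℕ.s≤s (ℕ.s≤s ℕ.z≤n)))
  convergent-bounds {a} a12 (suc n) =
    ≤-trans (≤-reflexive (sym (+-identityʳ 1ℚ))) (+-mono-≤ (proj₁ (digit (a 0) (a12 0))) 0≤y) ,
    +-mono-≤ (proj₂ (digit (a 0) (a12 0))) y≤1
    where
    c = convergent (λ i → a (suc i)) n
    y = recip c
    1≤c : 1ℚ ≤ c
    1≤c = proj₁ (convergent-bounds (a12 ∘ suc) n)
    0<c : 0ℚ < c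
    0<c = <-≤-trans 0<1 1≤c
    yc≡1 : y * c ≡ 1ℚ
    yc≡1 = recip-inverse c 0<c
    instance _ = positive 0<c
    0≤y : 0ℚ ≤ y
    0≤y = *-cancelʳ-≤-pos c (subst₂ _≤_ (sym (*-zeroˡ c)) (sym yc≡1) 0≤1)
    y≤1 : y ≤ 1ℚ
    y≤1 = *-cancelʳ-≤-pos c (subst₂ _≤_ (sym yc≡1) (sym (*-identityˡ c)) 1≤c)
    digit : ∀ x → OneOrTwo x → 1ℚ ≤ ι x × ι x ≤ 2ℚ
    digit _ (inj₁ refl) = ≤-refl , *≤* (ℤ.+≤+ (ℕ.s≤s ℕ.z≤n))
    digit _ (inj₂ refl) = *≤* (ℤ.+≤+ (ℕ.s≤s ℕ.z≤n)) , ≤-refl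

  -- The Möbius action of the matrix on convergents, with the denominator cleared.
  convergent-++ˢ : ∀ w s → (∀ i → OneOrTwo ((w ++ˢ s) i)) → ∀ n →
    let open Mat (matrix w); z = convergent s n in
    (ι C * z + ι D) * convergent (w ++ˢ s) (length w ℕ.+ n) ≡ ι A * z + ι B
  convergent-++ˢ [] s _ n = solve 1 (λ z → (con 0ℚ :* z :+ con 1ℚ) :* z := con 1ℚ :* z :+ con 0ℚ) refl (convergent s n)
  convergent-++ˢ (x ∷ w) s 12s n = begin
    (ι A * z + ι B) * (ι x + y)
      ≡⟨ *-distribˡ-+ (ι A * z + ι B) (ι x) y ⟩
    (ι A * z + ι B) * ι x + (ι A * z + ι B) * y
      ≡⟨ cong (λ t → (ι A * z + ι B) * ι x + t * y) (convergent-++ˢ w s (12s ∘ suc) n) ⟨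
    (ι A * z + ι B) * ι x + (ι C * z + ι D) * c * y
      ≡⟨ regroup (ι A) (ι B) (ι C) (ι D) (ι x) c y z ⟩
    (ι A * z + ι B) * ι x + (ι C * z + ι D) * (y * c)
      ≡⟨ cong (λ t → (ι A * z + ι B) * ι x + (ι C * z + ι D) * t) (recip-inverse c 0<c) ⟩
    (ι A * z + ι B) * ι x + (ι C * z + ι D) * 1ℚ
      ≡⟨ collect (ι A) (ι B) (ι C) (ι D) (ι x) z ⟩
    (ι x * ι A + ι C) * z + (ι x * ι B + ι D)
      ≡⟨ cong₂ (λ s t → s * z + t) (ι-*+ x A C) (ι-*+ x B D) ⟨
    ι (x ℕ.* A ℕ.+ C) * z + ι (x ℕ.* B ℕ.+ D) ∎
    where
    open ≡-Reasoning
    open Mat (matrix w)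
    z = convergent s n
    c = convergent (w ++ˢ s) (length w ℕ.+ n)
    y = recip c
    0<c : 0ℚ < c
    0<c = <-≤-trans 0<1 (proj₁ (convergent-bounds (12s ∘ suc) (length w ℕ.+ n)))
    regroup : ∀ A B C D x c y z →
      (A * z + B) * x + (C * z + D) * c * y ≡ (A * z + B) * x + (C * z + D) * (y * c)
    regroup = solve 8 (λ A B C D x c y z →
      (A :* z :+ B) :* x :+ (C :* z :+ D) :* c :* y := (A :* z :+ B) :* x :+ (C :* z :+ D) :* (y :* c)) refl
    collect : ∀ A B C D x z →
      (A * z + B) * x + (C * z + D) * 1ℚ ≡ (x * A + C) * z + (x * B + D)
    collect = solve 6 (λ A B C D x z →
      (A :* z :+ B) :* x :+ (C :* z :+ D) :* con 1ℚ := (x :* A :+ C) :* z :+ (x :* B :+ D)) refl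

  -- Each letter changes the sign of the determinant; the absolute value hides the parity of the
  -- length.
  ∣det∣≡1 : ∀ w → let open Mat (matrix w) in ∣ ι A * ι D - ι B * ι C ∣ ≡ 1ℚ
  ∣det∣≡1 [] = refl
  ∣det∣≡1 (x ∷ w) = begin
    ∣ ι (x ℕ.* A ℕ.+ C) * ι B - ι (x ℕ.* B ℕ.+ D) * ι A ∣
      ≡⟨ cong₂ (λ s t → ∣ s * ι B - t * ι A ∣) (ι-*+ x A C) (ι-*+ x B D) ⟩
    ∣ (ι x * ι A + ι C) * ι B - (ι x * ι B + ι D) * ι A ∣
      ≡⟨ cong ∣_∣ (expand (ι A) (ι B) (ι C) (ι D) (ι x)) ⟩
    ∣ - (ι A * ι D - ι B * ι C) ∣
      ≡⟨ ∣-p∣≡∣p∣ (ι A * ι D - ι B * ι C) ⟩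
    ∣ ι A * ι D - ι B * ι C ∣
      ≡⟨ ∣det∣≡1 w ⟩
    1ℚ ∎
    where
    open ≡-Reasoning
    open Mat (matrix w)
    expand : ∀ A B C D x → (x * A + C) * B - (x * B + D) * A ≡ - (A * D - B * C)
    expand = solve 5 (λ A B C D x → (x :* A :+ C) :* B :- (x :* B :+ D) :* A := :- (A :* D :- B :* C)) refl

  -- Convergence of a sequence on which a shift acts as a Möbius map.

  module QuadraticLimit (A B C D : ℚ) (1≤A : 1ℚ ≤ A) (1≤C : 1ℚ ≤ C) (1≤D : 1ℚ ≤ D)
    (∣AD-BC∣≡1 : ∣ A * D - B * C ∣ ≡ 1ℚ)
    (x : ℕ → ℚ) (1≤x : ∀ n → 1ℚ ≤ x n) (x≤3 : ∀ n → x n ≤ 3ℚ)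
    (N : ℕ) (möbius : ∀ n → (C * x n + D) * x (N ℕ.+ n) ≡ A * x n + B) where

    private
      -- Its roots are the fixed points of z ↦ (A z + B) / (C z + D).
      q : ℚ → ℚ
      q t = C * (t * t) + (D - A) * t + - B
      y : ℕ → ℚ
      y n = C * x n + D

      0≤C : 0ℚ ≤ C
      0≤C = ≤-trans 0≤1 1≤C

      2≤y : ∀ n → 2ℚ ≤ y n
      2≤y n = +-mono-≤ (≤-trans 1≤C (≤-*ʳ 0≤C (1≤x n))) 1≤D

      0≤2 : 0ℚ ≤ 2ℚ
      0≤2 = nonNegative⁻¹ 2ℚ

      0≤y : ∀ n → 0ℚ ≤ y n
      0≤y n = ≤-trans 0≤2 (2≤y n)

      2≤y² : ∀ n → 2ℚ ≤ y n * y n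
      2≤y² n = ≤-trans (2≤y n) (≤-*ʳ (0≤y n) (≤-trans (*≤* (ℤ.+≤+ (ℕ.s≤s ℕ.z≤n))) (2≤y n)))

      -- In homogeneous form, the fixed quadratic form is multiplied by the determinant when the
      -- matrix acts on its arguments.
      q-period : ∀ n → q (x (N ℕ.+ n)) * (y n * y n) ≡ (A * D - B * C) * q (x n)
      q-period n = begin
        q t * (y n * y n)                        ≡⟨ clear A B C D t (y n) ⟩
        form (y n * t)                           ≡⟨ cong form (möbius n) ⟩
        form (A * x n + B)                       ≡⟨ invariant A B C D (x n) ⟩
        (A * D - B * C) * q (x n)                ∎
        where
        open ≡-Reasoning
        t = x (N ℕ.+ n)
        form : ℚ → ℚ
        form u = C * (u * u) + (D - A) * (u * y n) + - B * (y n * y n)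
        clear : ∀ A B C D t y → (C * (t * t) + (D - A) * t + - B) * (y * y) ≡
                C * (y * t * (y * t)) + (D - A) * (y * t * y) + - B * (y * y)
        clear = solve 6 (λ A B C D t y → (C :* (t :* t) :+ (D :- A) :* t :+ :- B) :* (y :* y) :=
                C :* (y :* t :* (y :* t)) :+ (D :- A) :* (y :* t :* y) :+ :- B :* (y :* y)) refl
        invariant : ∀ A B C D z → let u = A * z + B; y = C * z + D in
          C * (u * u) + (D - A) * (u * y) + - B * (y * y) ≡
          (A * D - B * C) * (C * (z * z) + (D - A) * z + - B)
        invariant = solve 5 (λ A B C D z → let u = A :* z :+ B; y = C :* z :+ D in
          C :* (u :* u) :+ (D :- A) :* (u :* y) :+ :- B :* (y :* y) :=
          (A :* D :- B :* C) :* (C :* (z :* z) :+ (D :- A) :* z :+ :- B)) refl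

      q-halving : ∀ n → 2ℚ * ∣ q (x (N ℕ.+ n)) ∣ ≤ ∣ q (x n) ∣
      q-halving n = begin
        2ℚ * ∣ q t ∣                     ≤⟨ *-monoʳ (0≤∣p∣ (q t)) (2≤y² n) ⟩
        y n * y n * ∣ q t ∣              ≡⟨ cong (_* ∣ q t ∣) (0≤p⇒∣p∣≡p (≤-trans 0≤2 (2≤y² n))) ⟨
        ∣ y n * y n ∣ * ∣ q t ∣          ≡⟨ *-comm ∣ y n * y n ∣ ∣ q t ∣ ⟩
        ∣ q t ∣ * ∣ y n * y n ∣          ≡⟨ ∣p*q∣≡∣p∣*∣q∣ (q t) (y n * y n) ⟨
        ∣ q t * (y n * y n) ∣            ≡⟨ cong ∣_∣ (q-period n) ⟩
        ∣ (A * D - B * C) * q (x n) ∣    ≡⟨ ∣p*q∣≡∣p∣*∣q∣ (A * D - B * C) (q (x n)) ⟩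
        ∣ A * D - B * C ∣ * ∣ q (x n) ∣  ≡⟨ cong (_* ∣ q (x n) ∣) ∣AD-BC∣≡1 ⟩
        1ℚ * ∣ q (x n) ∣                 ≡⟨ *-identityˡ ∣ q (x n) ∣ ⟩
        ∣ q (x n) ∣                      ∎
        where
        open ≤-Reasoning
        t = x (N ℕ.+ n)

      q-bounded : ∀ n → ∣ q (x n) ∣ ≤ C * (3ℚ * 3ℚ) + ∣ D - A ∣ * 3ℚ + ∣ - B ∣
      q-bounded n = begin
        ∣ C * (t * t) + (D - A) * t + - B ∣           ≤⟨ ∣p+q∣≤∣p∣+∣q∣ (C * (t * t) + (D - A) * t) (- B) ⟩
        ∣ C * (t * t) + (D - A) * t ∣ + ∣ - B ∣       ≤⟨ +-monoˡ-≤ ∣ - B ∣ (∣p+q∣≤∣p∣+∣q∣ (C * (t * t)) ((D - A) * t)) ⟩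
        ∣ C * (t * t) ∣ + ∣ (D - A) * t ∣ + ∣ - B ∣   ≡⟨ cong₂ (λ u v → u + v + ∣ - B ∣) (0≤p⇒∣p∣≡p 0≤Ctt) ∣D-A∣t ⟩
        C * (t * t) + ∣ D - A ∣ * t + ∣ - B ∣         ≤⟨ +-monoˡ-≤ ∣ - B ∣ (+-mono-≤ (*-monoˡ 0≤C tt≤9) (*-monoˡ (0≤∣p∣ (D - A)) t≤3)) ⟩
        C * (3ℚ * 3ℚ) + ∣ D - A ∣ * 3ℚ + ∣ - B ∣      ∎
        where
        open ≤-Reasoning
        t = x n
        t≤3 : t ≤ 3ℚ
        t≤3 = x≤3 n
        0≤t : 0ℚ ≤ t
        0≤t = ≤-trans 0≤1 (1≤x n)
        0≤tt : 0ℚ ≤ t * t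
        0≤tt = ≤-trans 0≤t (≤-*ʳ 0≤t (1≤x n))
        0≤Ctt : 0ℚ ≤ C * (t * t)
        0≤Ctt = subst (_≤ C * (t * t)) (*-zeroʳ C) (*-monoˡ 0≤C 0≤tt)
        tt≤9 : t * t ≤ 3ℚ * 3ℚ
        tt≤9 = ≤-trans (*-monoˡ 0≤t t≤3) (*-monoʳ (nonNegative⁻¹ 3ℚ) t≤3)
        ∣D-A∣t : ∣ (D - A) * t ∣ ≡ ∣ D - A ∣ * t
        ∣D-A∣t = trans (∣p*q∣≡∣p∣*∣q∣ (D - A) t) (cong (∣ D - A ∣ *_) (0≤p⇒∣p∣≡p 0≤t))

    root : Null (λ n → C * (x n * x n) + (D - A) * x n + - B)
    root = null-halving (C * (3ℚ * 3ℚ) + ∣ D - A ∣ * 3ℚ + ∣ - B ∣) N q-bounded q-halving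

    private
      -- C x - A = ∓ 1 / y with y ≥ 2.
      -½≤Cx-A : ∀ n → - ½ ≤ C * x (N ℕ.+ n) - A
      -½≤Cx-A n = subst (- ½ ≤_) (solve 1 (λ v → :- (:- v) := v) refl v) (neg-antimono-≤ -v≤½)
        where
        open ≤-Reasoning
        t = x (N ℕ.+ n)
        v = C * t - A
        vy≡-det : v * y n ≡ - (A * D - B * C)
        vy≡-det = trans (solve 4 (λ A C t y → (C :* t :- A) :* y := C :* (y :* t) :- A :* y) refl A C t (y n))
          (trans (cong (λ u → C * u - A * y n) (möbius n))
            (solve 5 (λ A B C D z → C :* (A :* z :+ B) :- A :* (C :* z :+ D) := :- (A :* D :- B :* C)) refl A B C D (x n)))
        ∣v∣≤½ : ∣ v ∣ ≤ ½
        ∣v∣≤½ = *-cancelʳ-≤-pos 2ℚ (begin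
          ∣ v ∣ * 2ℚ               ≤⟨ *-monoˡ (0≤∣p∣ v) (2≤y n) ⟩
          ∣ v ∣ * y n              ≡⟨ cong (∣ v ∣ *_) (0≤p⇒∣p∣≡p (0≤y n)) ⟨
          ∣ v ∣ * ∣ y n ∣          ≡⟨ ∣p*q∣≡∣p∣*∣q∣ v (y n) ⟨
          ∣ v * y n ∣              ≡⟨ cong ∣_∣ vy≡-det ⟩
          ∣ - (A * D - B * C) ∣    ≡⟨ ∣-p∣≡∣p∣ (A * D - B * C) ⟩
          ∣ A * D - B * C ∣        ≡⟨ ∣AD-BC∣≡1 ⟩
          ½ * 2ℚ                   ∎)
        -v≤½ : - v ≤ ½
        -v≤½ = ≤-trans (≤∣∣ (- v)) (≤-trans (≤-reflexive (∣-p∣≡∣p∣ v)) ∣v∣≤½)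

      -- This is the cofactor of s - t in q(s) - q(t). Since C x ≥ A - ½ for both arguments, it is
      -- at least A + D - 1.
      1≤slope : ∀ m n → 1ℚ ≤ C * (x (N ℕ.+ m) + x (N ℕ.+ n)) + (D - A)
      1≤slope m n = begin
        - ½ + - ½ + (1ℚ + 1ℚ)                          ≤⟨ +-mono-≤ (+-mono-≤ (-½≤Cx-A m) (-½≤Cx-A n)) (+-mono-≤ 1≤A 1≤D) ⟩
        C * t - A + (C * t′ - A) + (A + D)             ≡⟨ solve 5 (λ A C D t t′ → C :* t :- A :+ (C :* t′ :- A) :+ (A :+ D) := C :* (t :+ t′) :+ (D :- A)) refl A C D t t′ ⟩
        C * (t + t′) + (D - A)                         ∎
        where
        open ≤-Reasoning
        t  = x (N ℕ.+ m)
        t′ = x (N ℕ.+ n)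

      -- Dividing q(x m) - q(x n) by a cofactor that is at least 1 shows that small values of q
      -- force close arguments. So `root` gives the Cauchy property before the limit is known.
      separation : ∀ m n → N ℕ.≤ m → N ℕ.≤ n → ∣ x m - x n ∣ ≤ ∣ q (x m) ∣ + ∣ q (x n) ∣
      separation m n m≥ n≥ = begin
        ∣ x m - x n ∣                          ≤⟨ ≤-*ʳ (0≤∣p∣ (x m - x n)) 1≤κ ⟩
        ∣ x m - x n ∣ * κ                      ≡⟨ cong (∣ x m - x n ∣ *_) (0≤p⇒∣p∣≡p (≤-trans 0≤1 1≤κ)) ⟨
        ∣ x m - x n ∣ * ∣ κ ∣                  ≡⟨ ∣p*q∣≡∣p∣*∣q∣ (x m - x n) κ ⟨
        ∣ (x m - x n) * κ ∣                    ≡⟨ cong ∣_∣ (factor A B C D (x m) (x n)) ⟩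
        ∣ q (x m) - q (x n) ∣                  ≤⟨ ∣p-q∣≤∣p∣+∣q∣ (q (x m)) (q (x n)) ⟩
        ∣ q (x m) ∣ + ∣ q (x n) ∣              ∎
        where
        open ≤-Reasoning
        κ = C * (x m + x n) + (D - A)
        1≤κ : 1ℚ ≤ κ
        1≤κ = subst₂ (λ i j → 1ℚ ≤ C * (x i + x j) + (D - A))
          (ℕ.m+[n∸m]≡n m≥) (ℕ.m+[n∸m]≡n n≥) (1≤slope (m ℕ.∸ N) (n ℕ.∸ N))
        factor : ∀ A B C D s t → (s - t) * (C * (s + t) + (D - A)) ≡
                 (C * (s * s) + (D - A) * s + - B) - (C * (t * t) + (D - A) * t + - B)
        factor = solve 6 (λ A B C D s t → (s :- t) :* (C :* (s :+ t) :+ (D :- A)) :=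
                 (C :* (s :* s) :+ (D :- A) :* s :+ :- B) :- (C :* (t :* t) :+ (D :- A) :* t :+ :- B)) refl

    cauchy-x : Cauchy x
    cauchy-x ε 0<ε =
      let M , small = root (½ * ε) (half 0<ε)
      in N ℕ.⊔ M , λ m n m≥ n≥ → ≤-<-trans
        (separation m n (max-≤ˡ N M m≥) (max-≤ˡ N M n≥))
        (subst (∣ q (x m) ∣ + ∣ q (x n) ∣ <_) (half+half ε)
          (+-mono-< (small m (max-≤ʳ N M m≥)) (small n (max-≤ʳ N M n≥))))
      where open CauchyProperties using (half; half+half; max-≤ˡ; max-≤ʳ)

    value : ℝ
    value = mkℝ x cauchy-x

    -- √δ is recovered as (2 C x + (D - A)) / f.
    value∈ℚ[√] : ∀ δ f → 0ℚ < f →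
      (D - A) * (D - A) - 4ℚ * C * - B ≡ ι δ * (f * f) → ℚ[√ δ ] value
    value∈ℚ[√] δ f 0<f disc = √δ , null-cong (λ n → sym (√δ²-δ n)) (null-scale (4ℚ * C * (1/ f * 1/ f)) root) ,
      -- The quadratic formula x = (A - D + f √δ) / (2 C), which holds here term by term.
      (A - D) * 1/ (2ℚ * C) , f * 1/ (2ℚ * C) , null-cong (λ n → sym (trans (cong (_- seq y′ n) (sym (coordinates n))) (+-inverseʳ (seq y′ n)))) null-0
      where
      open ≡-Reasoning
      0<2C : 0ℚ < 2ℚ * C
      0<2C = <-≤-trans (positive⁻¹ 2ℚ) (≤-*ʳ 0≤2 1≤C)
      instance
        _ = ≢-nonZero (0<⇒≢0 0<f)
        _ = ≢-nonZero (0<⇒≢0 0<2C)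
      √δ : ℝ
      √δ = fromℚ (1/ f) *ℝ (fromℚ (2ℚ * C) *ℝ value +ℝ fromℚ (D - A))
      y′ : ℝ
      y′ = fromℚ ((A - D) * 1/ (2ℚ * C)) +ℝ fromℚ (f * 1/ (2ℚ * C)) *ℝ √δ
      √δ²-δ : ∀ n → seq √δ n * seq √δ n - ι δ ≡ 4ℚ * C * (1/ f * 1/ f) * q (x n)
      √δ²-δ n = begin
        seq √δ n * seq √δ n - ι δ
          ≡⟨ cong (λ t → seq √δ n * seq √δ n - t) δ≡ ⟩
        seq √δ n * seq √δ n - ((D - A) * (D - A) - 4ℚ * C * - B) * (1/ f * 1/ f)
          ≡⟨ expand A B C D (1/ f) (x n) ⟩
        4ℚ * C * (1/ f * 1/ f) * q (x n) ∎
        where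
        δ≡ : ι δ ≡ ((D - A) * (D - A) - 4ℚ * C * - B) * (1/ f * 1/ f)
        δ≡ = begin
          ι δ                                       ≡⟨ solve 1 (λ d → d := d :* con 1ℚ :* con 1ℚ) refl (ι δ) ⟩
          ι δ * 1ℚ * 1ℚ                             ≡⟨ cong (λ t → ι δ * t * t) (*-inverseʳ f) ⟨
          ι δ * (f * 1/ f) * (f * 1/ f)             ≡⟨ solve 3 (λ d f i → d :* (f :* i) :* (f :* i) := d :* (f :* f) :* (i :* i)) refl (ι δ) f (1/ f) ⟩
          ι δ * (f * f) * (1/ f * 1/ f)             ≡⟨ cong (_* (1/ f * 1/ f)) disc ⟨
          ((D - A) * (D - A) - 4ℚ * C * - B) * (1/ f * 1/ f) ∎
        expand : ∀ A B C D i x →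
          i * (2ℚ * C * x + (D - A)) * (i * (2ℚ * C * x + (D - A))) - ((D - A) * (D - A) - 4ℚ * C * - B) * (i * i)
          ≡ 4ℚ * C * (i * i) * (C * (x * x) + (D - A) * x + - B)
        expand = solve 6 (λ A B C D i x →
          i :* (con 2ℚ :* C :* x :+ (D :- A)) :* (i :* (con 2ℚ :* C :* x :+ (D :- A)))
            :- ((D :- A) :* (D :- A) :- con 4ℚ :* C :* :- B) :* (i :* i)
          := con 4ℚ :* C :* (i :* i) :* (C :* (x :* x) :+ (D :- A) :* x :+ :- B)) refl
      coordinates : ∀ n → seq y′ n ≡ x n
      coordinates n = begin
        (A - D) * h + f * h * (1/ f * (2ℚ * C * x n + (D - A)))
          ≡⟨ regroup A C D f (1/ f) h (x n) ⟩
        (A - D) * h + f * 1/ f * (h * (2ℚ * C) * x n + (D - A) * h)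
          ≡⟨ cong₂ (λ s t → (A - D) * h + s * (t * x n + (D - A) * h)) (*-inverseʳ f) (*-inverseˡ (2ℚ * C)) ⟩
        (A - D) * h + 1ℚ * (1ℚ * x n + (D - A) * h)
          ≡⟨ cancel A D h (x n) ⟩
        x n ∎
        where
        h = 1/ (2ℚ * C)
        regroup : ∀ A C D f i h x → (A - D) * h + f * h * (i * (2ℚ * C * x + (D - A))) ≡
                  (A - D) * h + f * i * (h * (2ℚ * C) * x + (D - A) * h)
        regroup = solve 7 (λ A C D f i h x → (A :- D) :* h :+ f :* h :* (i :* (con 2ℚ :* C :* x :+ (D :- A))) :=
                  (A :- D) :* h :+ f :* i :* (h :* (con 2ℚ :* C) :* x :+ (D :- A) :* h)) refl
        cancel : ∀ A D h x → (A - D) * h + 1ℚ * (1ℚ * x + (D - A) * h) ≡ x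
        cancel = solve 4 (λ A D h x → (A :- D) :* h :+ con 1ℚ :* (con 1ℚ :* x :+ (D :- A) :* h) := x) refl

  -- Eliminating x² from the two quadratic equations leaves a linear one with leading coefficient
  -- `c′ * e - c * e′`, which `linear-trivial` forces to be 0.
  same-slope : ∀ {δ} → NonSquare δ → ∀ c e g c′ e′ g′ f (x x′ : ℝ) → f ≢ 0ℚ →
    e * e - 4ℚ * c * g ≡ ι δ * (f * f) →
    Null (λ n → c * (seq x n * seq x n) + e * seq x n + g) →
    Null (λ n → c′ * (seq x′ n * seq x′ n) + e′ * seq x′ n + g′) →
    x ≃ℝ x′ → c′ * e ≡ c * e′
  same-slope nonsq c e g c′ e′ g′ f x x′ f≢0 disc root root′ x≃x′ =
    p-q≡0⇒p≡q (linear-trivial nonsq x c e g (c′ * e - c * e′) (c′ * g - c * g′) f f≢0 disc root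
      (null-cong (λ n → eliminate c e g c′ e′ g′ (seq x n) (seq x′ n))
        (null-+ (null-scale c′ root) (null-scale (- c) (null-+ root′ (null-* sum difference))))))
    where
    difference : Null (λ n → seq x n - seq x′ n)
    difference = x≃x′
    -- Multiplied by x - x′, this is the difference of the second polynomial at x and at x′; it
    -- moves the second equation from x′ to x.
    sum : ℝ
    sum = fromℚ c′ *ℝ (x +ℝ x′) +ℝ fromℚ e′
    eliminate : ∀ c e g c′ e′ g′ x x′ →
      c′ * (c * (x * x) + e * x + g) +
        - c * (c′ * (x′ * x′) + e′ * x′ + g′ + (c′ * (x + x′) + e′) * (x - x′))
      ≡ (c′ * e - c * e′) * x + (c′ * g - c * g′)
    eliminate = solve 8 (λ c e g c′ e′ g′ x x′ →
      c′ :* (c :* (x :* x) :+ e :* x :+ g) :+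
        :- c :* (c′ :* (x′ :* x′) :+ e′ :* x′ :+ g′ :+ (c′ :* (x :+ x′) :+ e′) :* (x :- x′))
      := (c′ :* e :- c :* e′) :* x :+ (c′ :* g :- c :* g′)) refl

  -- The real number with a given period.

  ++ˢ-lookup : ∀ w s {i} (i<w : i ℕ.< length w) → lookup w (fromℕ< i<w) ≡ (w ++ˢ s) i
  ++ˢ-lookup (x ∷ w) s {zero}  _   = refl
  ++ˢ-lookup (x ∷ w) s {suc i} i<w = ++ˢ-lookup w s (ℕ.s<s⁻¹ i<w)

  ++ˢ-drop : ∀ w s i → (w ++ˢ s) (length w ℕ.+ i) ≡ s i
  ++ˢ-drop []      s i = refl
  ++ˢ-drop (x ∷ w) s i = ++ˢ-drop w s i

  module _ (x : ℕ) (w : List ℕ) (w12 : All OneOrTwo (x ∷ w)) where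

    private
      N = suc (length w)

    digits : Fin N → ℕ
    digits = lookup (x ∷ w)

    digits-12 : ∀ i → OneOrTwo (digits i)
    digits-12 i = All.lookup w12 (∈-lookup i)

    cycle : ℕ → ℕ
    cycle i = digits (i mod N)

    cycle-periodic : ∀ i → cycle i ≡ ((x ∷ w) ++ˢ cycle) i
    cycle-periodic i with i ℕ.<? N
    ... | yes i<N = trans (cong digits (fromℕ<-cong (i % N) i (m<n⇒m%n≡m i<N) (m%n<n i N) i<N))
                          (++ˢ-lookup (x ∷ w) cycle i<N)
    ... | no i≮N = begin
      cycle i                             ≡⟨ cong cycle (ℕ.m∸n+n≡m (ℕ.≮⇒≥ i≮N)) ⟨
      cycle (i′ ℕ.+ N)                    ≡⟨ cong digits (fromℕ<-cong ((i′ ℕ.+ N) % N) (i′ % N) ([m+n]%n≡m%n i′ N) (m%n<n (i′ ℕ.+ N) N) (m%n<n i′ N)) ⟩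
      cycle i′                            ≡⟨ ++ˢ-drop (x ∷ w) cycle i′ ⟨
      ((x ∷ w) ++ˢ cycle) (N ℕ.+ i′)      ≡⟨ cong ((x ∷ w) ++ˢ cycle) (ℕ.m+[n∸m]≡n (ℕ.≮⇒≥ i≮N)) ⟩
      ((x ∷ w) ++ˢ cycle) i               ∎
      where
      open ≡-Reasoning
      i′ = i ℕ.∸ N

    cycle-12 : ∀ i → OneOrTwo (cycle i)
    cycle-12 i = digits-12 (i mod N)

    open Mat (matrix (x ∷ w)) using () renaming (A to a; B to b; C to c; D to d)

    module Value (0<a : 0 ℕ.< a) (0<c : 0 ℕ.< c) (0<d : 0 ℕ.< d) where

      private
        module L = QuadraticLimit (ι a) (ι b) (ι c) (ι d) (ι-mono-≤ 0<a) (ι-mono-≤ 0<c) (ι-mono-≤ 0<d)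
          (∣det∣≡1 (x ∷ w)) (convergent cycle)
          (proj₁ ∘ convergent-bounds cycle-12) (proj₂ ∘ convergent-bounds cycle-12) N
          (λ n → trans (cong ((ι c * convergent cycle n + ι d) *_) (convergent-cong cycle-periodic (N ℕ.+ n)))
            (convergent-++ˢ (x ∷ w) cycle (λ i → subst OneOrTwo (cycle-periodic i) (cycle-12 i)) n))

      value : ℝ
      value = L.value

      value-root : Null (λ n → ι c * (seq value n * seq value n) + (ι d - ι a) * seq value n + - ι b)
      value-root = L.root

      value-periodic : PeriodicCF₁₂ value
      value-periodic = length w , digits , digits-12 ,
        -- The sequence of `value` consists of the convergents themselves, so the difference is
        -- constantly 0.
        null-cong (λ n → sym (+-inverseʳ (convergent cycle n))) null-0

      module _ (H δ f : ℕ) (a≡H+d : a ≡ H ℕ.+ d) (disc : H ℕ.* H ℕ.+ 4 ℕ.* (b ℕ.* c) ≡ δ ℕ.* (f ℕ.* f)) where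

        ιd-ιa : ι d - ι a ≡ - ι H
        ιd-ιa = trans (cong (λ t → ι d - t) (trans (cong ι a≡H+d) (ι-+ H d)))
          (solve 2 (λ d h → d :- (h :+ d) := :- h) refl (ι d) (ι H))

        ℚ-disc : (ι d - ι a) * (ι d - ι a) - 4ℚ * ι c * - ι b ≡ ι δ * (ι f * ι f)
        ℚ-disc = begin
          (ι d - ι a) * (ι d - ι a) - 4ℚ * ι c * - ι b   ≡⟨ cong (λ t → t * t - 4ℚ * ι c * - ι b) ιd-ιa ⟩
          - ι H * - ι H - 4ℚ * ι c * - ι b               ≡⟨ signs (ι H) (ι b) (ι c) ⟩
          ι H * ι H + 4ℚ * (ι b * ι c)                   ≡⟨ cong₂ (λ s t → s + 4ℚ * t) (ι-* H H) (ι-* b c) ⟨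
          ι (H ℕ.* H) + ι 4 * ι (b ℕ.* c)                ≡⟨ cong (_+_ (ι (H ℕ.* H))) (ι-* 4 (b ℕ.* c)) ⟨
          ι (H ℕ.* H) + ι (4 ℕ.* (b ℕ.* c))              ≡⟨ ι-+ (H ℕ.* H) (4 ℕ.* (b ℕ.* c)) ⟨
          ι (H ℕ.* H ℕ.+ 4 ℕ.* (b ℕ.* c))                ≡⟨ cong ι disc ⟩
          ι (δ ℕ.* (f ℕ.* f))                            ≡⟨ trans (ι-* δ (f ℕ.* f)) (cong (ι δ *_) (ι-* f f)) ⟩
          ι δ * (ι f * ι f)                              ∎
          where
          open ≡-Reasoning
          signs : ∀ h b c → - h * - h - 4ℚ * c * - b ≡ h * h + 4ℚ * (b * c)
          signs = solve 3 (λ h b c → :- h :* :- h :- con 4ℚ :* c :* :- b := h :* h :+ con 4ℚ :* (b :* c)) refl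

        value-field : 0 ℕ.< f → ℚ[√ δ ] value
        value-field 0<f = L.value∈ℚ[√] δ (ι f) (<-≤-trans 0<1 (ι-mono-≤ 0<f)) ℚ-disc

  -- It gives D > 0 for the period, whose entry D is the entry B of its tail. The letter 2 turns B
  -- into 2 B + D, which is at least B + D, and each further 1 does not decrease it.
  B-positive : ∀ k {v} → All OneOrTwo v → 0 ℕ.< Mat.B (matrix (replicate k 1 ++ 2 ∷ v))
  B-positive zero {v} v12 = ℕ.≤-trans (proj₂ (matrix-positive v12)) (ℕ.+-monoˡ-≤ D (ℕ.m≤n*m B 2))
    where open Mat (matrix v)
  B-positive (suc k) v12 = ℕ.≤-trans (B-positive k v12)
    (ℕ.≤-trans (ℕ.m≤n*m _ 1) (ℕ.m≤m+n _ _))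

  -- Infinitely many values in one field.

  module Family (h : ℕ) where

    open Period h using (p; r; word; tail; word-12; matrix-word; d; s; H′; f′; 0<f; slope-injective; δ-nonsquare)

    Δ : ℕ
    Δ = Formulas.δ ℕ._+_ ℕ._*_ (λ n → n) p r

    private
      tail-B : ∀ j → 0 ℕ.< Mat.B (matrix (tail j))
      tail-B j = B-positive (h ℕ.* 2) (All.tail (All.++⁻ʳ (replicate (h ℕ.* 2) 1) (All.tail (word-12 j))))

      module V (j : ℕ) = Value 1 (tail j) (word-12 j)
        (proj₁ (matrix-positive (word-12 j)))
        (proj₁ (matrix-positive (All.tail (word-12 j))))
        (tail-B j)

      module E (j : ℕ) = Mat (matrix (word j))

      A≡ : ∀ j → E.A j ≡ H′ j ℕ.+ E.D j
      A≡ j = subst (λ m → Mat.A m ≡ H′ j ℕ.+ Mat.D m) (sym (matrix-word j)) (A≡H+D p r (d j) (s j))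

      disc : ∀ j → H′ j ℕ.* H′ j ℕ.+ 4 ℕ.* (E.B j ℕ.* E.C j) ≡ Δ ℕ.* (f′ j ℕ.* f′ j)
      disc j = subst (λ m → H′ j ℕ.* H′ j ℕ.+ 4 ℕ.* (Mat.B m ℕ.* Mat.C m) ≡ Δ ℕ.* (f′ j ℕ.* f′ j))
        (sym (matrix-word j)) (discriminant p r (d j) (s j))

    x : ℕ → ℝ
    x = V.value

    x∈ℚ[√Δ] : ∀ j → ℚ[√ Δ ] (x j)
    x∈ℚ[√Δ] j = V.value-field j (H′ j) Δ (f′ j) (A≡ j) (disc j) (0<f j)

    x-periodic : ∀ j → PeriodicCF₁₂ (x j)
    x-periodic = V.value-periodic

    -- By `same-slope`, equal values give equal rational slopes (D - A) / C. Rewriting D - A as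
    -- -`H′` brings the equation to ℕ, where `slope-injective` applies.
    x-injective : ∀ i j → x i ≃ℝ x j → i ≡ j
    x-injective i j xi≃xj = slope-injective i j (begin
      H′ i ℕ.* Period.C h j    ≡⟨ cong (λ m → H′ i ℕ.* Mat.C m) (matrix-word j) ⟨
      H′ i ℕ.* E.C j           ≡⟨ ι-injective ι-eq ⟩
      H′ j ℕ.* E.C i           ≡⟨ cong (λ m → H′ j ℕ.* Mat.C m) (matrix-word i) ⟩
      H′ j ℕ.* Period.C h i    ∎)
      where
      open ≡-Reasoning
      slopes : ι (E.C j) * (ι (E.D i) - ι (E.A i)) ≡ ι (E.C i) * (ι (E.D j) - ι (E.A j))
      slopes = same-slope δ-nonsquare
        (ι (E.C i)) (ι (E.D i) - ι (E.A i)) (- ι (E.B i)) (ι (E.C j)) (ι (E.D j) - ι (E.A j)) (- ι (E.B j))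
        (ι (f′ i)) (x i) (x j)
        (0<⇒≢0 (<-≤-trans 0<1 (ι-mono-≤ (0<f i))))
        (V.ℚ-disc i (H′ i) Δ (f′ i) (A≡ i) (disc i)) (V.value-root i) (V.value-root j) xi≃xj
      flip : ∀ h c → - (c * - h) ≡ h * c
      flip = solve 2 (λ h c → :- (c :* :- h) := h :* c) refl
      ιd-ιa : ∀ i → ι (E.D i) - ι (E.A i) ≡ - ι (H′ i)
      ιd-ιa i = V.ιd-ιa i (H′ i) Δ (f′ i) (A≡ i) (disc i)
      ι-eq : ι (H′ i ℕ.* E.C j) ≡ ι (H′ j ℕ.* E.C i)
      ι-eq = begin
        ι (H′ i ℕ.* E.C j)                               ≡⟨ trans (ι-* (H′ i) (E.C j)) (sym (flip (ι (H′ i)) (ι (E.C j)))) ⟩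
        - (ι (E.C j) * - ι (H′ i))                       ≡⟨ cong (λ t → - (ι (E.C j) * t)) (ιd-ιa i) ⟨
        - (ι (E.C j) * (ι (E.D i) - ι (E.A i)))          ≡⟨ cong -_ slopes ⟩
        - (ι (E.C i) * (ι (E.D j) - ι (E.A j)))          ≡⟨ cong (λ t → - (ι (E.C i) * t)) (ιd-ιa j) ⟩
        - (ι (E.C i) * - ι (H′ j))                       ≡⟨ trans (flip (ι (H′ j)) (ι (E.C i))) (sym (ι-* (H′ j) (E.C i))) ⟩
        ι (H′ j ℕ.* E.C i)                               ∎

-- Infinitely many fields.

open Words using (module Period)
open Discriminants using (index; δᵢ; δ-coprime)
open Limits using (fields-differ; module Family)

mainTheorem2 :
  Infinite (λ δ δ′ → ℚ[√ δ ] ≐ ℚ[√ δ′ ])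
           (λ δ → NonSquare δ × Infinite _≃ℝ_ (ℚ[√ δ ] ∩ PeriodicCF₁₂))
mainTheorem2 = δᵢ , infinite , distinct
  where
  nonsquare : ∀ i → NonSquare (δᵢ i)
  nonsquare i = Period.δ-nonsquare (index i)
  infinite : ∀ i → NonSquare (δᵢ i) × Infinite _≃ℝ_ (ℚ[√ δᵢ i ] ∩ PeriodicCF₁₂)
  infinite i = nonsquare i , x , (λ j → x∈ℚ[√Δ] j , x-periodic j) , λ {j} {k} → x-injective j k
    where open Family (index i)
  distinct : ∀ {i j} → ℚ[√ δᵢ i ] ≐ ℚ[√ δᵢ j ] → i ≡ j
  distinct {i} {j} (⊆ , _) with i ℕ.≟ j
  ... | yes i≡j = i≡j
  ... | no i≢j  = contradiction (λ {x} → ⊆ {x})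
    (fields-differ (nonsquare i) (nonsquare j) (δ-coprime i≢j) sqrt)
    where
    sqrt : ∃[ s ] s *ℝ s ≃ℝ fromℕ (δᵢ i)
    -- Membership of the first continued fraction in the field comes with a real square root of δ.
    sqrt = let s , s²≃δ , _ = Family.x∈ℚ[√Δ] (index i) 0 in s , s²≃δ
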